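{- Let $q$ be a prime power and let $k=2t$ with $t\ge1$ an integer. The code $\mathcal{C}_{k,q}$ defined in the context is a minimal $\left[(q+1)\frac{k^2}{4},\,k,\,q(k-1)\right]_q$ code.
   Context: Codes: for $v\in\mathbb{F}_q^n$ the support is $\sigma(v)=\{i: v_i\neq0\}$ and the weight is $\omega(v)=|\sigma(v)|$. An $[n,k,d]_q$ code is a $k$-dimensional $\mathbb{F}_q$-linear subspace of $\mathbb{F}_q^n$ whose nonzero codewords have minimum weight $d$. A nonzero codeword $c\in\mathcal{C}$ is minimal if every $c'\in\mathcal{C}$ with $\sigma(c')\subseteq\sigma(c)$ is a scalar multiple of $c$; the code is minimal if all its nonzero codewords are minimal. Construction of $\mathcal{C}_{k,q}$: let $\gamma$ be a primitive element of $\mathbb{F}_{q^2}$ (a generator of $\mathbb{F}_{q^2}^*$), let $M\in\mathbb{F}_q^{2\times2}$ be the companion matrix of its minimal polynomial over $\mathbb{F}_q$, and let $\phi:\mathbb{F}_{q^2}\to\mathbb{F}_q[M]$ be the $\mathbb{F}_q$-algebra isomorphism with $\phi(\gamma)=M$. For a point $P=[(v_1,\dots,v_t)]\in\mathrm{PG}(t-1,q^2)$ let $\bar\varphi(P)\subseteq\mathbb{F}_q^{2t}$ be the $\mathbb{F}_q$-row space of the $2\times 2t$ matrix $(\phi(v_1)\mid\cdots\mid\phi(v_t))$; this is a 2-dimensional subspace (independent of the representative), i.e. a line of $\mathrm{PG}(k-1,q)$. With $e_1,\dots,e_t$ the standard basis of $\mathbb{F}_{q^2}^t$, put $P_\ell=[e_\ell]$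 and $Q_{\ell,m,i}=[e_\ell+\gamma^ie_m]$ for $1\le\ell<m\le t$. For every pair $1\le \ell<m\le t$ choose $i_{\ell,m},j_{\ell,m}\in\{1,\dots,q^2-1\}$ with $j_{\ell,m}-i_{\ell,m}\not\equiv0\bmod (q+1)$. The $t^2$ lines $\bar\varphi(P_\ell)$ $(1\le\ell\le t)$, $\bar\varphi(Q_{\ell,m,i_{\ell,m}})$ and $\bar\varphi(Q_{\ell,m,j_{\ell,m}})$ $(1\le\ell<m\le t)$ of $\mathrm{PG}(k-1,q)$ are pairwise disjoint. $\mathcal{C}_{k,q}$ is the code generated by a matrix with $k$ rows whose columns are vector representatives (one for each point) of all the points in the union of these $t^2$ lines. -}

module Defs where

open import Level using (Level; _⊔_) renaming (suc to lsuc)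
open import Algebra.Apartness.Bundles using (HeytingField; HeytingCommutativeRing)
open import Algebra.Bundles using (CommutativeRing)
open import Algebra.Bundles.Raw using (RawRing)
open import Algebra.Morphism.Structures using (IsRingHomomorphism; IsRingMonomorphism)
import Algebra.Definitions.RawSemiring as RawSemiringDefinitions
open import Data.Bool.Base using (if_then_else_; not)
open import Data.Fin.Base as Fin using (Fin; zero; suc; toℕ)
import Data.Fin.Properties as Fin
open import Data.Fin.Subset using (Subset; ∣_∣; _⊆_)
open import Data.Integer.Base using (+_; _-_)
import Data.Integer.Divisibility as ℤ
open import Data.Nat.Base as ℕ using (ℕ; _^_; _≤_; _<_; _∸_)
open import Data.Nat.Primality using (Prime)
open import Data.Product.Base using (Σ-syntax; ∃-syntax; _×_)
open import Data.Sum.Base using (_⊎_)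
open import Data.Vec.Base using (tabulate)
open import Data.Vec.Functional using (Vector; []; _∷_; map; zipWith; replicate; concat; transpose)
import Data.Vec.Functional.Relation.Binary.Equality.Setoid as VectorEquality
open import Function.Bundles using (Inverse)
open import Function.Properties.Inverse using (Inverse⇒Injection)
open import Relation.Binary.Definitions using (Decidable)
open import Relation.Binary.PropositionalEquality.Core using (_≡_)
open import Relation.Binary.PropositionalEquality.Properties using () renaming (setoid to ≡-setoid)
open import Relation.Nullary.Decidable using (does; via-injection)
open import Relation.Nullary.Negation using (¬_)
open import Relation.Unary using (Pred; _∈_; _≐_)

private
  variable
    a c c′ ℓ ℓ′ ℓ₁ ℓ₂ ℓ₁′ ℓ₂′ : Level
    k m n q t : ℕ

IsPrimePower : ℕ → Set
IsPrimePower q = ∃[ p ] ∃[ e ] (Prime p × 1 ≤ e × q ≡ p ^ e)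

-- A Heyting field with finitely many elements has decidable equality, so its
-- apartness relation coincides with inequality and it is a field in the
-- ordinary sense.
record FiniteField c ℓ₁ ℓ₂ (q : ℕ) : Set (lsuc (c ⊔ ℓ₁ ⊔ ℓ₂)) where
  field
    heytingField : HeytingField c ℓ₁ ℓ₂

  commutativeRing : CommutativeRing c ℓ₁
  commutativeRing =
    HeytingCommutativeRing.commutativeRing (HeytingField.heytingCommutativeRing heytingField)

  open CommutativeRing commutativeRing public

  field
    enumeration : Inverse setoid (≡-setoid (Fin q))

  infix 4 _≟_
  _≟_ : Decidable _≈_
  _≟_ = via-injection (Inverse⇒Injection enumeration) Fin._≟_

module _ (R : RawRing c ℓ) where
  open RawRing R
  open RawSemiringDefinitions rawSemiring using (sum) renaming (_^_ to _^ᴿ_)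

  -- Values at x ∈ R of polynomials over A, where η : A → R is the structure
  -- map of the A-algebra R.  The coefficient of Xⁱ is p i; the monic
  -- polynomial given by p : Vector A n is Xⁿ + p (n-1) Xⁿ⁻¹ + ⋯ + p 0.
  eval : {A : Set a} → (A → Carrier) → Vector A n → Carrier → Carrier
  eval η p x = sum (λ i → η (p i) * x ^ᴿ toℕ i)

  evalMonic : {A : Set a} → (A → Carrier) → Vector A n → Carrier → Carrier
  evalMonic {n = n} η p x = x ^ᴿ n + eval η p x

  -- p is the minimal polynomial of x: a monic annihilator of least degree.
  IsMinimalPolynomial : {A : Set a} → (A → Carrier) → Carrier → Vector A n → Set (a ⊔ ℓ)
  IsMinimalPolynomial {n = n} {A = A} η x p =
    evalMonic η p x ≈ 0# ×
    (∀ {m} → m < n → (r : Vector A m) → ¬ (evalMonic η r x ≈ 0#))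

module LinearAlgebra (F : FiniteField c ℓ₁ ℓ₂ q) where
  open FiniteField F hiding (zero)
  open RawSemiringDefinitions (RawRing.rawSemiring rawRing) using (sum)
  open RawSemiringDefinitions (RawRing.rawSemiring rawRing) public using () renaming (_^_ to _^ᶠ_)
  open VectorEquality setoid public using (_≋_)

  Primitive : Carrier → Set (c ⊔ ℓ₁)
  Primitive γ = ¬ (γ ≈ 0#) × (∀ x → ¬ (x ≈ 0#) → ∃[ e ] (x ≈ γ ^ᶠ e))

  0ᵛ : Vector Carrier n
  0ᵛ {n} = replicate n 0#

  infixl 6 _+ᵛ_
  _+ᵛ_ : Vector Carrier n → Vector Carrier n → Vector Carrier n
  _+ᵛ_ = zipWith _+_

  infixr 7 _·ᵛ_
  _·ᵛ_ : Carrier → Vector Carrier n → Vector Carrier n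
  x ·ᵛ v = map (x *_) v

  e : Fin n → Vector Carrier n
  e i j = if does (i Fin.≟ j) then 1# else 0#

  -- u and v represent the same point of projective space (for u , v nonzero).
  infix 4 _∼_
  _∼_ : Vector Carrier n → Vector Carrier n → Set (c ⊔ ℓ₁)
  u ∼ v = ∃[ x ] (¬ (x ≈ 0#) × u ≋ x ·ᵛ v)

  -- Matrix m n has m rows and n columns, and is the vector of its rows.
  Matrix : ℕ → ℕ → Set c
  Matrix m n = Vector (Vector Carrier n) m

  infixl 7 _ᵛ*_
  _ᵛ*_ : Vector Carrier m → Matrix m n → Vector Carrier n
  (u ᵛ* A) j = sum (λ i → u i * A i j)

  rowSpace : Matrix m n → Pred (Vector Carrier n) (c ⊔ ℓ₁)
  rowSpace A v = ∃[ u ] (v ≋ u ᵛ* A)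

  scalarMatrix : Carrier → Matrix n n
  scalarMatrix x i = x ·ᵛ e i

  matrixRawRing : ℕ → RawRing c ℓ₁
  matrixRawRing n = record
    { Carrier = Matrix n n
    ; _≈_     = λ A B → ∀ i → A i ≋ B i
    ; _+_     = λ A B i → A i +ᵛ B i
    ; _*_     = λ A B i → A i ᵛ* B
    ; -_      = λ A i → map -_ (A i)
    ; 0#      = λ i → 0ᵛ
    ; 1#      = e
    }

  -- The companion matrix of X² + p 1 X + p 0.
  companion : Vector Carrier 2 → Matrix 2 2
  companion p = (0# ∷ (- p zero)       ∷ [])
              ∷ (1# ∷ (- p (suc zero)) ∷ [])
              ∷ []

  -- F[M] as a subset of the n × n matrices.
  AdjoinMatrix : Matrix n n → Pred (Matrix n n) (c ⊔ ℓ₁)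
  AdjoinMatrix {n} M X =
    ∃[ d ] Σ[ p ∈ Vector Carrier d ] X ≈ᴹ eval (matrixRawRing n) scalarMatrix p M
    where open RawRing (matrixRawRing n) using () renaming (_≈_ to _≈ᴹ_)

  -- The columns of G are vector representatives, one for each point, of the
  -- points of the projective space on Fᵏ whose representatives lie in U.
  record ColumnsRepresentPointsOf (U : Pred (Vector Carrier k) ℓ) (G : Matrix k n)
         : Set (c ⊔ ℓ₁ ⊔ ℓ) where
    field
      nonzero  : ∀ j → ¬ (transpose G j ≋ 0ᵛ)
      inside   : ∀ j → transpose G j ∈ U
      distinct : ∀ {i j} → transpose G i ∼ transpose G j → i ≡ j
      covering : ∀ w → ¬ (w ≋ 0ᵛ) → w ∈ U → ∃[ j ] (w ∼ transpose G j)

  record IsSubspace (C : Pred (Vector Carrier n) ℓ) : Set (c ⊔ ℓ₁ ⊔ ℓ) where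
    field
      respects : ∀ {u v} → u ≋ v → u ∈ C → v ∈ C
      0ᵛ∈      : 0ᵛ ∈ C
      +ᵛ∈      : ∀ {u v} → u ∈ C → v ∈ C → u +ᵛ v ∈ C
      ·ᵛ∈      : ∀ x {v} → v ∈ C → x ·ᵛ v ∈ C

  LinearlyIndependentRows : Matrix k n → Set (c ⊔ ℓ₁)
  LinearlyIndependentRows B = ∀ u → u ᵛ* B ≋ 0ᵛ → u ≋ 0ᵛ

  HasDimension : Pred (Vector Carrier n) ℓ → ℕ → Set (c ⊔ ℓ₁ ⊔ ℓ)
  HasDimension {n} C k = Σ[ B ∈ Matrix k n ] (LinearlyIndependentRows B × C ≐ rowSpace B)

  σ : Vector Carrier n → Subset n
  σ v = tabulate (λ i → not (does (v i ≟ 0#)))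

  ω : Vector Carrier n → ℕ
  ω v = ∣ σ v ∣

  IsMinimumWeight : Pred (Vector Carrier n) ℓ → ℕ → Set (c ⊔ ℓ₁ ⊔ ℓ)
  IsMinimumWeight C d =
    (∃[ v ] (v ∈ C × ¬ (v ≋ 0ᵛ) × ω v ≡ d)) ×
    (∀ v → v ∈ C → ¬ (v ≋ 0ᵛ) → d ≤ ω v)

  record Is[_,_,_]Code (n k d : ℕ) (C : Pred (Vector Carrier m) ℓ) : Set (c ⊔ ℓ₁ ⊔ ℓ) where
    field
      length        : m ≡ n
      isSubspace    : IsSubspace C
      dimension     : HasDimension C k
      minimumWeight : IsMinimumWeight C d

  IsMinimalCodeword : Pred (Vector Carrier n) ℓ → Vector Carrier n → Set (c ⊔ ℓ₁ ⊔ ℓ)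
  IsMinimalCodeword C v = ∀ v′ → v′ ∈ C → σ v′ ⊆ σ v → ∃[ x ] (v′ ≋ x ·ᵛ v)

  IsMinimalCode : Pred (Vector Carrier n) ℓ → Set (c ⊔ ℓ₁ ⊔ ℓ)
  IsMinimalCode C = ∀ v → v ∈ C → ¬ (v ≋ 0ᵛ) → IsMinimalCodeword C v

record FieldReduction (F : FiniteField c ℓ₁ ℓ₂ q) (K : FiniteField c′ ℓ₁′ ℓ₂′ (q ^ 2))
       : Set (c ⊔ ℓ₁ ⊔ c′ ⊔ ℓ₁′) where
  private
    module F = FiniteField F
    module K = FiniteField K
    module Fᴸ = LinearAlgebra F
    module Kᴸ = LinearAlgebra K
    open RawRing (Fᴸ.matrixRawRing 2) using () renaming (_≈_ to _≈ᴹ_)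

  field
    ι                    : F.Carrier → K.Carrier
    ι-isRingHomomorphism : IsRingHomomorphism F.rawRing K.rawRing ι
    γ                    : K.Carrier
    γ-primitive          : Kᴸ.Primitive γ
    minPoly              : Vector F.Carrier 2
    minPoly-isMinimal    : IsMinimalPolynomial K.rawRing ι γ minPoly

  M : Fᴸ.Matrix 2 2
  M = Fᴸ.companion minPoly

  -- φ is an isomorphism of F-algebras from K onto F[M] sending γ to M.
  field
    φ                    : K.Carrier → Fᴸ.Matrix 2 2
    φ-isRingMonomorphism : IsRingMonomorphism K.rawRing (Fᴸ.matrixRawRing 2) φ
    φ-ι                  : ∀ x → φ (ι x) ≈ᴹ Fᴸ.scalarMatrix x
    φ-into               : ∀ x → φ x ∈ Fᴸ.AdjoinMatrix M
    φ-onto               : ∀ X → X ∈ Fᴸ.AdjoinMatrix M → ∃[ x ] (φ x ≈ᴹ X)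
    φ-γ                  : φ γ ≈ᴹ M

  -- The subspace φ̄([v]) of F²ᵗ, for a representative v of a point; the rows
  -- of (φ(v₁) ∣ ⋯ ∣ φ(vₜ)) are concatenations of rows of the blocks.
  φ̄ : Vector K.Carrier t → Pred (Vector F.Carrier (t ℕ.* 2)) (c ⊔ ℓ₁)
  φ̄ v = Fᴸ.rowSpace (λ r → concat (λ ℓ → φ (v ℓ) r))

  P : Fin t → Vector K.Carrier t
  P ℓ = Kᴸ.e ℓ

  Q : Fin t → Fin t → ℕ → Vector K.Carrier t
  Q ℓ m i = Kᴸ.e ℓ Kᴸ.+ᵛ (γ Kᴸ.^ᶠ i) Kᴸ.·ᵛ Kᴸ.e m

  -- The union of the lines; only the values i ℓ m and j ℓ m with ℓ < m matter.
  UnionOfLines : (i j : Fin t → Fin t → ℕ) → Pred (Vector F.Carrier (t ℕ.* 2)) (c ⊔ ℓ₁)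
  UnionOfLines {t} i j w =
    (∃[ ℓ ] w ∈ φ̄ (P {t} ℓ)) ⊎
    (∃[ ℓ ] ∃[ m ] (ℓ Fin.< m × (w ∈ φ̄ (Q ℓ m (i ℓ m)) ⊎ w ∈ φ̄ (Q ℓ m (j ℓ m)))))

record AdmissibleExponents (q i j : ℕ) : Set where
  field
    1≤i    : 1 ≤ i
    i≤q²-1 : i ≤ q ^ 2 ∸ 1
    1≤j    : 1 ≤ j
    j≤q²-1 : j ≤ q ^ 2 ∸ 1
    i≢j    : ¬ ((+ (q ℕ.+ 1)) ℤ.∣ ((+ j) - (+ i)))

-- For a message u write uₗ ∈ F² for its blocks and let K act on F² through φ.
-- The line of v = (v₁ , … , vₜ) lies in the hyperplane u^⊥ iff Σ vₗ uₗ = 0 in F²;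
-- otherwise exactly q of its points lie outside.  So the weight of u G is q times
-- the number of lines with Σ vₗ uₗ ≠ 0.  If uₐ ≠ 0, this counts P a and, for every
-- b ≠ a, at least two of P b and the two lines of the pair {a , b}; a message with
-- one nonzero block attains the bound 1 + 2 (t − 1) = k − 1.
--
-- If the zeros of u G are zeros of u′ G, then on every line the value of u′ is an
-- F-multiple of the value of u.  The lines P ℓ give u′ₗ = λₗ uₗ.  If λₗ ≠ λₘ with
-- uₗ , uₘ ≠ 0, the two lines of {ℓ , m} show that uₗ is an F-multiple of both γⁱ uₘ
-- and γʲ uₘ, so γʲ⁻ⁱ ∈ F and q + 1 divides j − i, contrary to the hypothesis.
module Submission where

open import Defs
open import Algebra.Apartness.Bundles using (HeytingField)
import Algebra.Apartness.Properties.HeytingCommutativeRing as HeytingCommutativeRingProperties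
open import Algebra.Bundles using (CommutativeMonoid)
open import Algebra.Morphism.Structures using (IsRingHomomorphism; IsRingMonomorphism)
import Algebra.Properties.CommutativeMonoid.Sum as CommutativeMonoidSum
import Algebra.Properties.CommutativeSemiring.Exp as CommutativeSemiringExp
import Algebra.Properties.Monoid.Mult as MonoidMult
import Algebra.Properties.Ring as RingProperties
import Algebra.Properties.Semiring.Exp as SemiringExp
import Algebra.Properties.Semiring.Sum as SemiringSum
open import Data.Bool.Base using (Bool; true; false; if_then_else_; not)
open import Data.Fin.Base as Fin
  using (Fin; zero; suc; toℕ; fromℕ<; punchIn; _↑ˡ_; _↑ʳ_; combine; remQuot)
import Data.Fin.Permutation as Permutation
import Data.Fin.Properties as Fin
open import Data.Fin.Subset using (∣_∣; _⊆_)
import Data.Integer.Base as ℤ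
import Data.Integer.Divisibility as ℤ
import Data.Integer.Properties as ℤ
open import Data.Nat.Base as ℕ using (ℕ; zero; suc; _∸_; _≤_; _<_; z≤n; s≤s; NonZero)
import Data.Nat.Divisibility as ℕ
import Data.Nat.DivMod as ℕ
import Data.Nat.Properties as ℕ
open import Data.Nat.Tactic.RingSolver using (solve-∀)
open import Data.Product.Base using (∃-syntax; _×_; _,_; proj₁; proj₂)
open import Data.Sum.Base using (_⊎_; inj₁; inj₂)
open import Data.Vec.Base using (tabulate; lookup)
open import Data.Vec.Functional using (Vector; []; _∷_; replicate; removeAt; concat; transpose)
import Data.Vec.Properties as Vec
open import Function.Base using (_∘_; id)
open import Function.Bundles using (Inverse)
open import Level using (Level)
open import Relation.Binary.Definitions using (Tri; tri<; tri≈; tri>)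
open import Relation.Binary.PropositionalEquality.Core as ≡ using (_≡_; _≢_)
import Relation.Binary.PropositionalEquality.Properties as ≡
import Relation.Binary.Reasoning.Setoid as SetoidReasoning
open import Relation.Nullary.Decidable using (Dec; yes; no; does; dec-true)
open import Relation.Nullary.Negation using (¬_; contradiction)

private
  variable
    a c c′ ℓ₁ ℓ₂ ℓ₁′ ℓ₂′ : Level
    A B : Set a
    k m n q t : ℕ


-- The divisibility at the very end comes from raising ι c γⁱ = ι c′ γʲ to the power q - 1: Fermat
-- in F kills the constants, so γ^((j - i)(q - 1)) = 1, while γ has order q² - 1 = (q + 1)(q - 1).
-- Both Fermat and the order of γ are obtained by counting over the enumerations of F and K. Length
-- and weight rest on the lines being pairwise disjoint, for only then do the columns of G
-- correspond one to one to a line together with one of its q + 1 points. Disjointness is derived by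
-- reading a point a (φ(v₁) ∣ ⋯ ∣ φ(vₜ)) blockwise: a nonzero element of K acts invertibly, so the
-- nonzero blocks reveal the support of v, and a block with vₛ = 1 reveals a.

concat-combine : (xss : Vector (Vector A n) m) → ∀ i j → concat xss (combine i j) ≡ xss i j
concat-combine xss i j = ≡.cong (λ (i , j) → xss i j) (Fin.remQuot-combine i j)

-- Finite sums in a commutative monoid.

module FiniteSums (M : CommutativeMonoid c ℓ₁) where
  open CommutativeMonoid M
  open CommutativeMonoidSum M
  open MonoidMult monoid using () renaming (_×_ to _⋆_)
  open SetoidReasoning setoid

  sum-++ : ∀ m {n} (f : Vector Carrier (m ℕ.+ n)) →
           sum f ≈ sum (λ i → f (i ↑ˡ n)) ∙ sum (λ j → f (m ↑ʳ j))
  sum-++ zero    f = sym (identityˡ _)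
  sum-++ (suc m) f = trans (∙-congˡ (sum-++ m (f ∘ suc))) (sym (assoc _ _ _))

  sum-combine : ∀ m {n} (f : Vector Carrier (m ℕ.* n)) →
                sum f ≈ ∑[ i < m ] ∑[ j < n ] f (combine i j)
  sum-combine zero        f = refl
  sum-combine (suc m) {n} f = trans (sum-++ n f) (∙-congˡ (sum-combine m (λ j → f (n ↑ʳ j))))

  sum-single : (f : Vector Carrier n) (i : Fin n) → (∀ j → j ≢ i → f j ≈ ε) → sum f ≈ f i
  sum-single {suc n} f i f≈ε = begin
    sum f                     ≈⟨ sum-remove {i = i} f ⟩
    f i ∙ sum (removeAt f i)  ≈⟨ ∙-congˡ (sum-cong-≋ (λ j → f≈ε _ (Fin.punchInᵢ≢i i j))) ⟩
    f i ∙ sum (replicate n ε) ≈⟨ ∙-congˡ (sum-replicate-zero n) ⟩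
    f i ∙ ε                   ≈⟨ identityʳ _ ⟩
    f i                       ∎

  -- Serves two monoids: in the multiplicative one it produces the power x^(q - 1) in Fermat's
  -- theorem, in the additive one it counts the points of a line off a hyperplane.
  sum-all-but-one : (f : Vector Carrier n) (i : Fin n) {x : Carrier} → f i ≈ ε →
                    (∀ j → j ≢ i → f j ≈ x) → sum f ≈ (n ∸ 1) ⋆ x
  sum-all-but-one {suc n} f i {x} fi≈ε f≈x = begin
    sum f                     ≈⟨ sum-remove {i = i} f ⟩
    f i ∙ sum (removeAt f i)  ≈⟨ ∙-cong fi≈ε (sum-cong-≋ (λ j → f≈x _ (Fin.punchInᵢ≢i i j))) ⟩
    ε ∙ sum (replicate n x)   ≈⟨ identityˡ _ ⟩
    sum (replicate n x)       ≈⟨ sum-replicate n ⟩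
    n ⋆ x                     ∎

-- Finite fields: inverses, Fermat's theorem, the order of a primitive element.

module FiniteFieldProperties (F : FiniteField c ℓ₁ ℓ₂ q) where
  open FiniteField F hiding (zero)
  open HeytingField heytingField using (heytingCommutativeRing; tight; #⇒invertible)
  open HeytingCommutativeRingProperties heytingCommutativeRing using (1#0; x-0≈x)
  open RingProperties ring using (x∙y⁻¹≈ε⇒x≈y; x[y-z]≈xy-xz; +-cancelʳ; //-rightDividesˡ)
  open LinearAlgebra F using (_^ᶠ_; Primitive)
  open SemiringExp semiring using (^-homo-*; ^-assocʳ; ^-congˡ)
  open CommutativeMonoidSum *-commutativeMonoid using ()
    renaming (sum to product; sum-permute to product-permute; ∑-distrib-+ to product-distrib-*
             ; sum-cong-≋ to product-cong)
  open Inverse enumeration using (to; from; to-cong; strictlyInverseˡ; strictlyInverseʳ)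
  open SetoidReasoning setoid

  to-injective : ∀ {x y} → to x ≡ to y → x ≈ y
  to-injective {x} {y} eq = begin
    x           ≈⟨ strictlyInverseʳ x ⟨
    from (to x) ≡⟨ ≡.cong from eq ⟩
    from (to y) ≈⟨ strictlyInverseʳ y ⟩
    y           ∎

  1≉0 : ¬ (1# ≈ 0#)
  1≉0 1≈0 = proj₂ (tight 1# 0#) 1≈0 1#0

  -- An element that is not invertible is not apart from 0, hence equal to 0.
  x*y≈0⇒y≈0 : ∀ {x y} → ¬ (x ≈ 0#) → x * y ≈ 0# → y ≈ 0#
  x*y≈0⇒y≈0 {x} {y} x≉0 xy≈0 = proj₁ (tight y 0#) λ y#0 →
    let (y⁻¹ , _ , inv) = #⇒invertible y#0 in
    x≉0 (begin
      x                     ≈⟨ *-identityʳ x ⟨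
      x * 1#                ≈⟨ *-congˡ inv ⟨
      x * ((y - 0#) * y⁻¹)  ≈⟨ *-congˡ (*-congʳ (x-0≈x y)) ⟩
      x * (y * y⁻¹)         ≈⟨ *-assoc x y y⁻¹ ⟨
      x * y * y⁻¹           ≈⟨ *-congʳ xy≈0 ⟩
      0# * y⁻¹              ≈⟨ zeroˡ y⁻¹ ⟩
      0#                    ∎)

  x*y≉0 : ∀ {x y} → ¬ (x ≈ 0#) → ¬ (y ≈ 0#) → ¬ (x * y ≈ 0#)
  x*y≉0 x≉0 y≉0 xy≈0 = y≉0 (x*y≈0⇒y≈0 x≉0 xy≈0)

  x-y≈0⇒x≈y : ∀ {x y} → x - y ≈ 0# → x ≈ y
  x-y≈0⇒x≈y = x∙y⁻¹≈ε⇒x≈y _ _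

  a+b≈c+d⇒a-c≈d-b : ∀ {a b c d} → a + b ≈ c + d → a - c ≈ d - b
  a+b≈c+d⇒a-c≈d-b {a} {b} {c} {d} eq = +-cancelʳ (c + b) _ _ (begin
    a - c + (c + b)  ≈⟨ +-assoc _ c b ⟨
    a - c + c + b    ≈⟨ +-congʳ (//-rightDividesˡ c a) ⟩
    a + b            ≈⟨ eq ⟩
    c + d            ≈⟨ +-comm c d ⟩
    d + c            ≈⟨ +-congʳ (//-rightDividesˡ b d) ⟨
    d - b + b + c    ≈⟨ +-assoc _ b c ⟩
    d - b + (b + c)  ≈⟨ +-congˡ (+-comm b c) ⟩
    d - b + (c + b)  ∎)

  *-cancelˡ-≉0 : ∀ {x y z} → ¬ (x ≈ 0#) → x * y ≈ x * z → y ≈ z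
  *-cancelˡ-≉0 {x} {y} {z} x≉0 xy≈xz = x-y≈0⇒x≈y (x*y≈0⇒y≈0 x≉0 (begin
    x * (y - z)    ≈⟨ x[y-z]≈xy-xz x y z ⟩
    x * y - x * z  ≈⟨ +-congʳ xy≈xz ⟩
    x * z - x * z  ≈⟨ -‿inverseʳ (x * z) ⟩
    0#             ∎))

  ^-≉0 : ∀ {x} n → ¬ (x ≈ 0#) → ¬ (x ^ᶠ n ≈ 0#)
  ^-≉0 zero    x≉0 = 1≉0
  ^-≉0 (suc n) x≉0 = x*y≉0 x≉0 (^-≉0 n x≉0)

  1^n≈1 : ∀ n → 1# ^ᶠ n ≈ 1#
  1^n≈1 zero    = refl
  1^n≈1 (suc n) = trans (*-identityˡ _) (1^n≈1 n)

  -- Two of the powers x⁰, …, x^q coincide.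
  inverse : ∀ {x} → ¬ (x ≈ 0#) → ∃[ y ] (x * y ≈ 1#)
  inverse {x} x≉0 with Fin.pigeonhole (ℕ.n<1+n q) (λ i → to (x ^ᶠ toℕ i))
  ... | i , j , i<j , xⁱ≡xʲ with ℕ.m≤n⇒∃[o]m+o≡n i<j
  -- Here j = i + (1 + o), so cancelling xⁱ in xⁱ = xʲ leaves x · xᵒ = 1.
  ... | o , 1+i+o≡j = x ^ᶠ o , *-cancelˡ-≉0 (^-≉0 (toℕ i) x≉0) (begin
    x ^ᶠ toℕ i * (x ^ᶠ suc o)  ≈⟨ ^-homo-* x (toℕ i) (suc o) ⟨
    x ^ᶠ (toℕ i ℕ.+ suc o)     ≡⟨ ≡.cong (x ^ᶠ_) (≡.trans (ℕ.+-suc (toℕ i) o) 1+i+o≡j) ⟩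
    x ^ᶠ toℕ j                 ≈⟨ to-injective xⁱ≡xʲ ⟨
    x ^ᶠ toℕ i                 ≈⟨ *-identityʳ _ ⟨
    x ^ᶠ toℕ i * 1#            ∎)

  *-permutation : ∀ {x} → ¬ (x ≈ 0#) → Permutation.Permutation q q
  *-permutation {x} x≉0 with inverse x≉0
  ... | y , xy≈1 = Permutation.permutation
          (λ i → to (x * from i)) (λ i → to (y * from i))
          (cancel xy≈1) (cancel (trans (*-comm y x) xy≈1))
    where
    cancel : ∀ {x y} → x * y ≈ 1# → ∀ i → to (x * from (to (y * from i))) ≡ i
    cancel {x} {y} xy≈1 i = ≡.trans (to-cong (begin
      x * from (to (y * from i)) ≈⟨ *-congˡ (strictlyInverseʳ _) ⟩
      x * (y * from i)           ≈⟨ *-assoc x y _ ⟨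
      x * y * from i             ≈⟨ *-congʳ xy≈1 ⟩
      1# * from i                ≈⟨ *-identityˡ _ ⟩
      from i                     ∎)) (strictlyInverseˡ i)

  product-≉0 : (f : Vector Carrier n) → (∀ i → ¬ (f i ≈ 0#)) → ¬ (product f ≈ 0#)
  product-≉0 {zero}  f f≉0 = 1≉0
  product-≉0 {suc n} f f≉0 = x*y≉0 (f≉0 zero) (product-≉0 (f ∘ suc) (f≉0 ∘ suc))

  -- Gives the element 0 the neutral factor 1, so that a product over the nonzero elements can be
  -- written over the whole enumeration.
  unless-0 : Carrier → Carrier → Carrier
  unless-0 y x with y ≟ 0#
  ... | yes _ = 1#
  ... | no  _ = x

  unless-0-yes : ∀ {y x} → y ≈ 0# → unless-0 y x ≈ 1#
  unless-0-yes {y} y≈0 with y ≟ 0#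
  ... | yes _   = refl
  ... | no  y≉0 = contradiction y≈0 y≉0

  unless-0-no : ∀ {y x} → ¬ (y ≈ 0#) → unless-0 y x ≈ x
  unless-0-no {y} y≉0 with y ≟ 0#
  ... | yes y≈0 = contradiction y≈0 y≉0
  ... | no  _   = refl

  -- Multiplication by x permutes the nonzero elements, so it does not change
  -- their product.
  fermat : ∀ {x} → ¬ (x ≈ 0#) → x ^ᶠ (q ∸ 1) ≈ 1#
  fermat {x} x≉0 = begin
    x ^ᶠ (q ∸ 1)                      ≈⟨ sum-all-but-one factor (to 0#) factor-0 factor-≢0 ⟨
    product factor                    ≈⟨ *-cancelˡ-≉0 (product-≉0 units units≉0) cancelled ⟩
    1#                                ∎
    where
    open FiniteSums *-commutativeMonoid
    -- `factor` multiplies to x^(q - 1), `units` to the product of all nonzero elements.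
    factor units : Vector Carrier q
    factor i = unless-0 (from i) x
    units  i = unless-0 (from i) (from i)

    factor-0 : factor (to 0#) ≈ 1#
    factor-0 = unless-0-yes (strictlyInverseʳ 0#)

    factor-≢0 : ∀ i → i ≢ to 0# → factor i ≈ x
    factor-≢0 i i≢0 = unless-0-no λ eq →
      i≢0 (≡.trans (≡.sym (strictlyInverseˡ i)) (to-cong eq))

    units≉0 : ∀ i → ¬ (units i ≈ 0#)
    units≉0 i with from i ≟ 0#
    ... | yes _   = 1≉0
    ... | no  i≉0 = i≉0

    shift : ∀ i → units (*-permutation x≉0 Permutation.⟨$⟩ʳ i) ≈ units i * factor i
    shift i with inverse x≉0
    ... | y , xy≈1 with from i ≟ 0# | from (to (x * from i)) ≟ 0#
    ... | yes i≈0 | yes _    = sym (*-identityˡ 1#)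
    ... | yes i≈0 | no  xi≉0 =
      contradiction (trans (strictlyInverseʳ _) (trans (*-congˡ i≈0) (zeroʳ x))) xi≉0
    ... | no  i≉0 | yes xi≈0 =
      contradiction (trans (sym (strictlyInverseʳ _)) xi≈0) (x*y≉0 x≉0 i≉0)
    ... | no  i≉0 | no  _    = trans (strictlyInverseʳ _) (*-comm x _)

    cancelled : product units * product factor ≈ product units * 1#
    cancelled = begin
      product units * product factor          ≈⟨ product-distrib-* units factor ⟨
      product (λ i → units i * factor i)      ≈⟨ product-cong shift ⟨
      product (λ i → units (*-permutation x≉0 Permutation.⟨$⟩ʳ i))
                                              ≈⟨ product-permute units (*-permutation x≉0) ⟨
      product units                           ≈⟨ *-identityʳ _ ⟨
      product units * 1#                      ∎

  ^-% : ∀ {x} n r → .{{_ : NonZero r}} → x ^ᶠ r ≈ 1# → x ^ᶠ (n ℕ.% r) ≈ x ^ᶠ n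
  ^-% {x} n r xʳ≈1 = begin
    x ^ᶠ (n ℕ.% r)                             ≈⟨ *-identityʳ _ ⟨
    x ^ᶠ (n ℕ.% r) * 1#                        ≈⟨ *-congˡ (1^n≈1 (n ℕ./ r)) ⟨
    x ^ᶠ (n ℕ.% r) * 1# ^ᶠ (n ℕ./ r)           ≈⟨ *-congˡ (^-congˡ (n ℕ./ r) xʳ≈1) ⟨
    x ^ᶠ (n ℕ.% r) * (x ^ᶠ r) ^ᶠ (n ℕ./ r)     ≈⟨ *-congˡ (^-assocʳ x r (n ℕ./ r)) ⟩
    x ^ᶠ (n ℕ.% r) * x ^ᶠ (r ℕ.* (n ℕ./ r))    ≈⟨ ^-homo-* x (n ℕ.% r) _ ⟨
    x ^ᶠ (n ℕ.% r ℕ.+ r ℕ.* (n ℕ./ r))         ≡⟨ ≡.cong (λ s → x ^ᶠ (n ℕ.% r ℕ.+ s)) (ℕ.*-comm r (n ℕ./ r)) ⟩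
    x ^ᶠ (n ℕ.% r ℕ.+ n ℕ./ r ℕ.* r)           ≡⟨ ≡.cong (x ^ᶠ_) (ℕ.m≡m%n+[m/n]*n n r) ⟨
    x ^ᶠ n                                     ∎

  -- If γʳ = 1 then 0 and the powers γ⁰, …, γʳ⁻¹ are all the elements.
  order-≥ : ∀ {γ} → Primitive γ → ∀ r → .{{_ : NonZero r}} → γ ^ᶠ r ≈ 1# → q ≤ suc r
  order-≥ {γ} (γ≉0 , logarithm) r γʳ≈1 = Fin.injective⇒≤ {f = index ∘ from} λ {i} {j} eq →
      from-injective (begin
        from i                  ≈⟨ element-index (from i) ⟨
        element (index (from i)) ≡⟨ ≡.cong element eq ⟩
        element (index (from j)) ≈⟨ element-index (from j) ⟩
        from j                  ∎)
    where
    from-injective : ∀ {i j} → from i ≈ from j → i ≡ j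
    from-injective {i} {j} eq =
      ≡.trans (≡.sym (strictlyInverseˡ i)) (≡.trans (to-cong eq) (strictlyInverseˡ j))

    element : Fin (suc r) → Carrier
    element zero    = 0#
    element (suc e) = γ ^ᶠ toℕ e

    index : Carrier → Fin (suc r)
    index x with x ≟ 0#
    ... | yes _   = zero
    ... | no  x≉0 = suc (fromℕ< (ℕ.m%n<n (proj₁ (logarithm x x≉0)) r))

    element-index : ∀ x → element (index x) ≈ x
    element-index x with x ≟ 0#
    ... | yes x≈0 = sym x≈0
    ... | no  x≉0 = begin
      γ ^ᶠ toℕ (fromℕ< (ℕ.m%n<n e r))  ≡⟨ ≡.cong (γ ^ᶠ_) (Fin.toℕ-fromℕ< (ℕ.m%n<n e r)) ⟩
      γ ^ᶠ (e ℕ.% r)                   ≈⟨ ^-% e r γʳ≈1 ⟩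
      γ ^ᶠ e                           ≈⟨ proj₂ (logarithm x x≉0) ⟨
      x                                ∎
      where e = proj₁ (logarithm x x≉0)

  2≤q : 2 ≤ q
  2≤q = Fin.injective⇒≤ {m = 2} {f = two} two-injective
    where
    two : Fin 2 → Fin q
    two zero    = to 0#
    two (suc _) = to 1#

    two-injective : ∀ {i j} → two i ≡ two j → i ≡ j
    two-injective {zero}     {zero}     _  = ≡.refl
    two-injective {suc zero} {suc zero} _  = ≡.refl
    two-injective {zero}     {suc zero} eq = contradiction (sym (to-injective eq)) 1≉0
    two-injective {suc zero} {zero}     eq = contradiction (to-injective eq) 1≉0

  suc[q-1]≡q : suc (q ∸ 1) ≡ q
  suc[q-1]≡q = ℕ.suc-pred q {{ℕ.>-nonZero (ℕ.≤-trans (s≤s z≤n) 2≤q)}}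

  -- By Fermat the remainder r of n modulo q - 1 still satisfies γʳ = 1. If 0 < r < q - 1, then
  -- `order-≥` would bound the number of elements by r + 1 < q.
  order-∣ : ∀ {γ} → Primitive γ → ∀ n → γ ^ᶠ n ≈ 1# → (q ∸ 1) ℕ.∣ n
  order-∣ {γ} prim@(γ≉0 , _) n γⁿ≈1 =
    ℕ.m%n≡0⇒n∣m n (q ∸ 1) (remainder≡0 (n ℕ.% (q ∸ 1)) γʳ≈1 (ℕ.m%n<n n (q ∸ 1)))
    where
    instance
      q-1≢0 : NonZero (q ∸ 1)
      q-1≢0 = ℕ.>-nonZero (ℕ.m<n⇒0<n∸m 2≤q)

    remainder≡0 : ∀ r → γ ^ᶠ r ≈ 1# → r < q ∸ 1 → r ≡ 0
    remainder≡0 zero      _    _     = ≡.refl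
    remainder≡0 r@(suc _) γʳ≈1 r<q-1 =
      contradiction (order-≥ prim r γʳ≈1)
        (ℕ.<⇒≱ (ℕ.≤-trans (s≤s r<q-1) (ℕ.≤-reflexive suc[q-1]≡q)))

    γʳ≈1 : γ ^ᶠ (n ℕ.% (q ∸ 1)) ≈ 1#
    γʳ≈1 = trans (^-% n (q ∸ 1) (fermat γ≉0)) γⁿ≈1

-- Sums of natural numbers over a square array, and counting by indicators.

module ℕ-Sum = CommutativeMonoidSum ℕ.+-0-commutativeMonoid
open ℕ-Sum using () renaming (sum to ∑)

∑-mono-≤ : {f g : Vector ℕ n} → (∀ i → f i ≤ g i) → ∑ f ≤ ∑ g
∑-mono-≤ {zero}  f≤g = z≤n
∑-mono-≤ {suc n} f≤g = ℕ.+-mono-≤ (f≤g zero) (∑-mono-≤ (f≤g ∘ suc))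

∑-ones : ∀ n → ∑ {n} (λ _ → 1) ≡ n
∑-ones zero    = ≡.refl
∑-ones (suc n) = ≡.cong suc (∑-ones n)

∑-const-* : ∀ x (f : Vector ℕ n) → ∑ (λ i → x ℕ.* f i) ≡ x ℕ.* ∑ f
∑-const-* x f = ≡.sym (SemiringSum.*-distribˡ-sum ℕ.+-*-semiring x f)

term≤∑ : (f : Vector ℕ n) (i : Fin n) → f i ≤ ∑ f
term≤∑ f zero    = ℕ.m≤m+n (f zero) _
term≤∑ f (suc i) = ℕ.≤-trans (term≤∑ (f ∘ suc) i) (ℕ.m≤n+m _ (f zero))

∑-const-≤ : (f : Vector ℕ n) {x : ℕ} → (∀ i → f i ≤ x) → ∑ f ≤ n ℕ.* x
∑-const-≤ {zero}  f f≤x = z≤n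
∑-const-≤ {suc n} f f≤x = ℕ.+-mono-≤ (f≤x zero) (∑-const-≤ (f ∘ suc) (f≤x ∘ suc))

∑-const-≥ : (f : Vector ℕ n) {x : ℕ} → (∀ i → x ≤ f i) → n ℕ.* x ≤ ∑ f
∑-const-≥ {zero}  f x≤f = z≤n
∑-const-≥ {suc n} f x≤f = ℕ.+-mono-≤ (x≤f zero) (∑-const-≥ (f ∘ suc) (x≤f ∘ suc))

module _ (f : Fin (suc n) → Fin (suc n) → ℕ) (a : Fin (suc n)) where
  ∑∑-remove : ∑ (λ x → ∑ (f x)) ≡
              f a a ℕ.+ ∑ (λ x → f a (punchIn a x)) ℕ.+
              ∑ (λ x → f (punchIn a x) a ℕ.+ ∑ (λ y → f (punchIn a x) (punchIn a y)))
  ∑∑-remove = ≡.trans (ℕ-Sum.sum-remove {i = a} (λ x → ∑ (f x)))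
    (≡.cong₂ ℕ._+_ (ℕ-Sum.sum-remove {i = a} (f a))
                   (ℕ-Sum.sum-cong-≗ (λ x → ℕ-Sum.sum-remove {i = a} (f (punchIn a x)))))

  -- The cell (a , a) contributes 1. For distinct b ≠ a the triples (a , b), (b , a), (b , b) share
  -- no cell, so each adds its own 2; of the cells outside row and column a only the diagonal ones
  -- are kept.
  ∑∑-≥-cross : 1 ≤ f a a → (∀ b → b ≢ a → 2 ≤ f a b ℕ.+ (f b a ℕ.+ f b b)) →
               suc (n ℕ.* 2) ≤ ∑ (λ x → ∑ (f x))
  ∑∑-≥-cross 1≤faa 2≤ = begin
    suc (n ℕ.* 2)
      ≤⟨ ℕ.+-mono-≤ 1≤faa (∑-const-≥ _ (λ x → 2≤ (b x) (Fin.punchInᵢ≢i a x))) ⟩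
    f a a ℕ.+ ∑ (λ x → f a (b x) ℕ.+ (f (b x) a ℕ.+ f (b x) (b x)))
      ≡⟨ ≡.cong (f a a ℕ.+_) (ℕ-Sum.∑-distrib-+ (λ x → f a (b x)) (λ x → f (b x) a ℕ.+ f (b x) (b x))) ⟩
    f a a ℕ.+ (∑ (λ x → f a (b x)) ℕ.+ ∑ (λ x → f (b x) a ℕ.+ f (b x) (b x)))
      ≡⟨ ℕ.+-assoc (f a a) _ _ ⟨
    f a a ℕ.+ ∑ (λ x → f a (b x)) ℕ.+ ∑ (λ x → f (b x) a ℕ.+ f (b x) (b x))
      ≤⟨ ℕ.+-monoʳ-≤ (f a a ℕ.+ ∑ (λ x → f a (b x)))
           (∑-mono-≤ (λ x → ℕ.+-monoʳ-≤ (f (b x) a) (term≤∑ (λ y → f (b x) (b y)) x))) ⟩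
    f a a ℕ.+ ∑ (λ x → f a (b x)) ℕ.+ ∑ (λ x → f (b x) a ℕ.+ ∑ (λ y → f (b x) (b y)))
      ≡⟨ ∑∑-remove ⟨
    ∑ (λ x → ∑ (f x)) ∎
    where
    open ℕ.≤-Reasoning
    b = punchIn a

  -- Everything is concentrated on row a and column a, which together have 1 + 2n cells.
  ∑∑-≤-cross : (∀ x y → f x y ≤ 1) → (∀ x y → x ≢ a → y ≢ a → f x y ≤ 0) →
               ∑ (λ x → ∑ (f x)) ≤ suc (n ℕ.* 2)
  ∑∑-≤-cross f≤1 f≤0 = begin
    ∑ (λ x → ∑ (f x))
      ≡⟨ ∑∑-remove ⟩
    f a a ℕ.+ ∑ (λ x → f a (b x)) ℕ.+ ∑ (λ x → f (b x) a ℕ.+ ∑ (λ y → f (b x) (b y)))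
      ≤⟨ ℕ.+-mono-≤ (ℕ.+-mono-≤ (f≤1 a a) (∑-const-≤ _ (λ x → f≤1 a (b x))))
           (∑-const-≤ _ λ x → ℕ.+-mono-≤ (f≤1 (b x) a)
             (ℕ.≤-trans (∑-const-≤ _ (λ y → f≤0 (b x) (b y) (Fin.punchInᵢ≢i a x) (Fin.punchInᵢ≢i a y)))
                        (ℕ.≤-reflexive (ℕ.*-zeroʳ n)))) ⟩
    suc (n ℕ.* 1 ℕ.+ n ℕ.* 1)
      ≡⟨ ≡.cong suc (ℕ.*-distribˡ-+ n 1 1) ⟨
    suc (n ℕ.* 2) ∎
    where
    open ℕ.≤-Reasoning
    b = punchIn a

suc[n*2]≡2*suc[n]∸1 : ∀ n → suc (n ℕ.* 2) ≡ 2 ℕ.* suc n ∸ 1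
suc[n*2]≡2*suc[n]∸1 n = ≡.trans (≡.cong suc (ℕ.*-comm n 2)) (≡.sym (ℕ.+-suc n (n ℕ.+ 0)))

-- The index `a` forces n to be positive, so the subtraction in `2 * n ∸ 1` is never truncated.
∑∑-≥ : (f : Fin n → Fin n → ℕ) (a : Fin n) → 1 ≤ f a a → (∀ b → b ≢ a → 2 ≤ f a b ℕ.+ (f b a ℕ.+ f b b)) →
       2 ℕ.* n ∸ 1 ≤ ∑ (λ x → ∑ (f x))
∑∑-≥ {suc n} f a 1≤ 2≤ = ≡.subst (_≤ ∑ (λ x → ∑ (f x))) (suc[n*2]≡2*suc[n]∸1 n) (∑∑-≥-cross f a 1≤ 2≤)

∑∑-≤ : (f : Fin n → Fin n → ℕ) (a : Fin n) → (∀ x y → f x y ≤ 1) → (∀ x y → x ≢ a → y ≢ a → f x y ≤ 0) →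
       ∑ (λ x → ∑ (f x)) ≤ 2 ℕ.* n ∸ 1
∑∑-≤ {suc n} f a f≤1 f≤0 = ≡.subst (∑ (λ x → ∑ (f x)) ≤_) (suc[n*2]≡2*suc[n]∸1 n) (∑∑-≤-cross f a f≤1 f≤0)

-- The indicator of the negation; in this form the weight of a vector is literally a sum of such
-- indicators.
fails : Dec A → ℕ
fails A? = if does A? then 0 else 1

fails-yes : (A? : Dec A) → A → fails A? ≡ 0
fails-yes (yes _) _ = ≡.refl
fails-yes (no ¬a) a = contradiction a ¬a

fails-no : (A? : Dec A) → ¬ A → fails A? ≡ 1
fails-no (yes a) ¬a = contradiction a ¬a
fails-no (no _)  _  = ≡.refl

fails-≤1 : (A? : Dec A) → fails A? ≤ 1
fails-≤1 (yes _) = z≤n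
fails-≤1 (no _)  = s≤s z≤n

fails-cong : (A? : Dec A) (B? : Dec B) → (A → B) → (B → A) → fails A? ≡ fails B?
fails-cong (yes a) B? f g = ≡.sym (fails-yes B? (f a))
fails-cong (no ¬a) B? f g = ≡.sym (fails-no B? (¬a ∘ g))

∣tabulate-not∣ : (f : Fin n → Bool) → ∣ tabulate (λ i → not (f i)) ∣ ≡ ∑ (λ i → if f i then 0 else 1)
∣tabulate-not∣ {zero}  f = ≡.refl
∣tabulate-not∣ {suc n} f with f zero
... | true  = ∣tabulate-not∣ (f ∘ suc)
... | false = ≡.cong suc (∣tabulate-not∣ (f ∘ suc))

-- Linear algebra over F and criteria for proportionality.

module VectorProperties (F : FiniteField c ℓ₁ ℓ₂ q) where
  open FiniteField F hiding (zero)
  open LinearAlgebra F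
  open FiniteFieldProperties F
  open SemiringSum semiring
  open RingProperties ring using (-‿distribˡ-*; [y-z]x≈yx-zx)
  open SetoidReasoning setoid
  open FiniteSums +-commutativeMonoid using (sum-combine; sum-single)

  ω≡∑ : (v : Vector Carrier n) → ω v ≡ ∑ (λ i → fails (v i ≟ 0#))
  ω≡∑ v = ∣tabulate-not∣ (λ i → does (v i ≟ 0#))

  infix 4 _≋0?
  _≋0? : (v : Vector Carrier n) → Dec (v ≋ 0ᵛ)
  v ≋0? = Fin.all? (λ i → v i ≟ 0#)

  nonzero-entry : (v : Vector Carrier n) → ¬ (v ≋ 0ᵛ) → ∃[ i ] (¬ (v i ≈ 0#))
  nonzero-entry v = Fin.¬∀⟶∃¬ _ _ (λ i → v i ≟ 0#)

  infix 8 _∙_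
  _∙_ : Vector Carrier n → Vector Carrier n → Carrier
  u ∙ v = sum (λ i → u i * v i)

  infixr 7 _*ᵛ_
  _*ᵛ_ : Matrix m n → Vector Carrier n → Vector Carrier m
  (A *ᵛ v) i = A i ∙ v

  ∙-cong : {u u′ v v′ : Vector Carrier n} → u ≋ u′ → v ≋ v′ → u ∙ v ≈ u′ ∙ v′
  ∙-cong u≋u′ v≋v′ = sum-cong-≋ (λ i → *-cong (u≋u′ i) (v≋v′ i))

  ∙-comm : (u v : Vector Carrier n) → u ∙ v ≈ v ∙ u
  ∙-comm u v = sum-cong-≋ (λ i → *-comm (u i) (v i))

  ∙-zeroˡ : (v : Vector Carrier n) → 0ᵛ ∙ v ≈ 0#
  ∙-zeroˡ {n} v = trans (sum-cong-≋ (λ i → zeroˡ (v i))) (sum-replicate-zero n)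

  ∙-distribʳ-+ : (w u v : Vector Carrier n) → (u +ᵛ v) ∙ w ≈ u ∙ w + v ∙ w
  ∙-distribʳ-+ w u v = trans (sum-cong-≋ (λ i → distribʳ (w i) (u i) (v i)))
                             (∑-distrib-+ (λ i → u i * w i) (λ i → v i * w i))

  ∙-·ˡ : ∀ x (u v : Vector Carrier n) → (x ·ᵛ u) ∙ v ≈ x * (u ∙ v)
  ∙-·ˡ x u v = trans (sum-cong-≋ (λ i → *-assoc x (u i) (v i)))
                     (sym (*-distribˡ-sum x (λ i → u i * v i)))

  ∙-distribˡ-+ : (w u v : Vector Carrier n) → w ∙ (u +ᵛ v) ≈ w ∙ u + w ∙ v
  ∙-distribˡ-+ w u v = trans (sum-cong-≋ (λ i → distribˡ (w i) (u i) (v i)))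
                             (∑-distrib-+ (λ i → w i * u i) (λ i → w i * v i))

  ∙-·ʳ : ∀ x (u v : Vector Carrier n) → u ∙ (x ·ᵛ v) ≈ x * (u ∙ v)
  ∙-·ʳ x u v = trans (∙-comm u _) (trans (∙-·ˡ x v u) (*-congˡ (∙-comm v u)))

  ∙-zeroʳ : (v : Vector Carrier n) → v ∙ 0ᵛ ≈ 0#
  ∙-zeroʳ v = trans (∙-comm v 0ᵛ) (∙-zeroˡ v)

  e-≡ : {i j : Fin n} → i ≡ j → e i j ≈ 1#
  e-≡ {i = i} {j} i≡j with i Fin.≟ j
  ... | yes _   = refl
  ... | no  i≢j = contradiction i≡j i≢j

  e-≢ : {i j : Fin n} → i ≢ j → e i j ≈ 0#
  e-≢ {i = i} {j} i≢j with i Fin.≟ j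
  ... | yes i≡j = contradiction i≡j i≢j
  ... | no  _   = refl

  e-∙ : (i : Fin n) (v : Vector Carrier n) → e i ∙ v ≈ v i
  e-∙ i v = begin
    e i ∙ v       ≈⟨ sum-single _ i (λ j j≢i → trans (*-congʳ (e-≢ (j≢i ∘ ≡.sym))) (zeroˡ (v j))) ⟩
    e i i * v i   ≈⟨ *-congʳ (e-≡ {i = i} ≡.refl) ⟩
    1# * v i      ≈⟨ *-identityˡ (v i) ⟩
    v i           ∎

  e-sym : (i j : Fin n) → e i j ≈ e j i
  e-sym i j with i Fin.≟ j
  ... | yes ≡.refl = sym (e-≡ {i = i} ≡.refl)
  ... | no  i≢j    = sym (e-≢ (i≢j ∘ ≡.sym))

  ᵛ*-e : (v : Vector Carrier n) → v ᵛ* e ≋ v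
  ᵛ*-e v j = trans (sum-cong-≋ (λ i → trans (*-comm _ _) (*-congʳ (e-sym i j)))) (e-∙ j v)

  ᵛ*-∙ : (u : Vector Carrier m) (A : Matrix m n) (v : Vector Carrier n) →
         (u ᵛ* A) ∙ v ≈ u ∙ (A *ᵛ v)
  ᵛ*-∙ u A v = begin
    sum (λ j → sum (λ i → u i * A i j) * v j)
      ≈⟨ sum-cong-≋ (λ j → *-distribʳ-sum (v j) (λ i → u i * A i j)) ⟩
    sum (λ j → sum (λ i → u i * A i j * v j))
      ≈⟨ ∑-comm (λ j i → u i * A i j * v j) ⟩
    sum (λ i → sum (λ j → u i * A i j * v j))
      ≈⟨ sum-cong-≋ (λ i → sum-cong-≋ (λ j → *-assoc (u i) (A i j) (v j))) ⟩
    sum (λ i → sum (λ j → u i * (A i j * v j)))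
      ≈⟨ sum-cong-≋ (λ i → *-distribˡ-sum (u i) (λ j → A i j * v j)) ⟨
    sum (λ i → u i * sum (λ j → A i j * v j))
      ∎

  concat-∙ : (xss : Vector (Vector Carrier n) m) (v : Vector Carrier (m ℕ.* n)) →
             concat xss ∙ v ≈ sum (λ i → xss i ∙ (λ j → v (combine i j)))
  concat-∙ {m = m} xss v = trans (sum-combine m _)
    (sum-cong-≋ (λ i → sum-cong-≋ (λ j → *-congʳ (reflexive (concat-combine xss i j)))))

  rowSpace-isSubspace : (A : Matrix m n) → IsSubspace (rowSpace A)
  rowSpace-isSubspace A = record
    { respects = λ u≋v (x , u≋xA) → x , λ j → trans (sym (u≋v j)) (u≋xA j)
    ; 0ᵛ∈      = 0ᵛ , λ j → sym (∙-zeroˡ (λ i → A i j))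
    ; +ᵛ∈      = λ (x , u≋xA) (y , v≋yA) →
                   x +ᵛ y , λ j → trans (+-cong (u≋xA j) (v≋yA j)) (sym (∙-distribʳ-+ (λ i → A i j) x y))
    ; ·ᵛ∈      = λ z (x , v≋xA) → z ·ᵛ x , λ j → trans (*-congˡ (v≋xA j)) (sym (∙-·ˡ z x (λ i → A i j)))
    }

  rowSpace-dimension : {A : Matrix m n} → m ≡ k → LinearlyIndependentRows A → HasDimension (rowSpace A) k
  rowSpace-dimension {A = A} ≡.refl independent = A , independent , id , id

  ∼-trans : {u v w : Vector Carrier n} → u ∼ v → v ∼ w → u ∼ w
  ∼-trans (x , x≉0 , u≋xv) (y , y≉0 , v≋yw) =
    x * y , x*y≉0 x≉0 y≉0 , λ i → trans (u≋xv i) (trans (*-congˡ (v≋yw i)) (sym (*-assoc x y _)))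

  ∙-pair : ∀ a b y → (a ∷ b ∷ []) ∙ y ≈ a * y zero + b * y (suc zero)
  ∙-pair a b y = +-congˡ (+-identityʳ _)

  -- The scalar is the quotient of the entries at a position r with yᵣ ≠ 0; the vanishing 2 × 2
  -- minors carry it to every other position.
  parallel : (y y′ : Vector Carrier n) → (∀ r s → y r * y′ s ≈ y s * y′ r) →
             ¬ (y ≋ 0ᵛ) → ∃[ x ] (y′ ≋ x ·ᵛ y)
  parallel y y′ cross y≉0 with nonzero-entry y y≉0
  ... | r , yᵣ≉0 with inverse yᵣ≉0
  ... | z , yᵣz≈1 = y′ r * z , λ s → begin
    y′ s               ≈⟨ *-identityʳ _ ⟨
    y′ s * 1#          ≈⟨ *-congˡ yᵣz≈1 ⟨
    y′ s * (y r * z)   ≈⟨ *-assoc _ _ z ⟨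
    y′ s * y r * z     ≈⟨ *-congʳ (trans (*-comm _ _) (cross r s)) ⟩
    y s * y′ r * z     ≈⟨ *-assoc _ _ z ⟩
    y s * (y′ r * z)   ≈⟨ *-comm _ _ ⟩
    y′ r * z * y s     ∎

  ·≋0⇒≈0 : ∀ {x} {y : Vector Carrier n} → ¬ (y ≋ 0ᵛ) → x ·ᵛ y ≋ 0ᵛ → x ≈ 0#
  ·≋0⇒≈0 {y = y} y≉0 xy≋0 = let (r , yᵣ≉0) = nonzero-entry y y≉0 in
    x*y≈0⇒y≈0 yᵣ≉0 (trans (*-comm _ _) (xy≋0 r))

  -- (x - z) y = (z - x′) Z, and neither coefficient can vanish.
  proportional : ∀ (y Z : Vector Carrier n) {x x′ z} → ¬ (y ≋ 0ᵛ) → ¬ (Z ≋ 0ᵛ) → ¬ (x ≈ x′) →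
                 x ·ᵛ y +ᵛ x′ ·ᵛ Z ≋ z ·ᵛ (y +ᵛ Z) → ∃[ c ] (¬ (c ≈ 0#) × y ≋ c ·ᵛ Z)
  proportional y Z {x} {x′} {z} y≉0 Z≉0 x≉x′ eq = conclude (inverse d≉0)
    where
    d d′ : Carrier
    d  = x - z
    d′ = z - x′

    dy≋d′Z : d ·ᵛ y ≋ d′ ·ᵛ Z
    dy≋d′Z r = begin
      d * y r            ≈⟨ [y-z]x≈yx-zx (y r) x z ⟩
      x * y r - z * y r  ≈⟨ a+b≈c+d⇒a-c≈d-b (trans (eq r) (distribˡ z (y r) (Z r))) ⟩
      z * Z r - x′ * Z r ≈⟨ [y-z]x≈yx-zx (Z r) z x′ ⟨
      d′ * Z r           ∎

    -- Since y and Z are nonzero, one vanishing coefficient makes the other vanish too, and then x =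
    -- z = x′.
    ≈0-≈0 : d ≈ 0# → ¬ (d′ ≈ 0#)
    ≈0-≈0 d≈0 d′≈0 = x≉x′ (trans (x-y≈0⇒x≈y d≈0) (x-y≈0⇒x≈y d′≈0))

    d≉0 : ¬ (d ≈ 0#)
    d≉0 d≈0 = ≈0-≈0 d≈0 (·≋0⇒≈0 Z≉0 λ r → trans (sym (dy≋d′Z r)) (trans (*-congʳ d≈0) (zeroˡ (y r))))

    d′≉0 : ¬ (d′ ≈ 0#)
    d′≉0 d′≈0 = ≈0-≈0 (·≋0⇒≈0 y≉0 λ r → trans (dy≋d′Z r) (trans (*-congʳ d′≈0) (zeroˡ (Z r)))) d′≈0

    conclude : ∃[ d⁻¹ ] (d * d⁻¹ ≈ 1#) → ∃[ c ] (¬ (c ≈ 0#) × y ≋ c ·ᵛ Z)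
    conclude (d⁻¹ , dd⁻¹≈1) = d⁻¹ * d′ , x*y≉0 d⁻¹≉0 d′≉0 , λ r → begin
      y r              ≈⟨ *-identityˡ _ ⟨
      1# * y r         ≈⟨ *-congʳ (trans (*-comm d⁻¹ d) dd⁻¹≈1) ⟨
      d⁻¹ * d * y r    ≈⟨ *-assoc d⁻¹ d _ ⟩
      d⁻¹ * (d * y r)  ≈⟨ *-congˡ (dy≋d′Z r) ⟩
      d⁻¹ * (d′ * Z r) ≈⟨ *-assoc d⁻¹ d′ _ ⟨
      d⁻¹ * d′ * Z r   ∎
      where
      d⁻¹≉0 : ¬ (d⁻¹ ≈ 0#)
      d⁻¹≉0 eq = 1≉0 (trans (sym dd⁻¹≈1) (trans (*-congˡ eq) (zeroʳ d)))

  -- The perpendicular of y ∈ F² is spanned by (y₁ , -y₀).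
  ⊥-parallel : (y y′ : Vector Carrier 2) → (∀ a → a ∙ y ≈ 0# → a ∙ y′ ≈ 0#) → ∃[ x ] (y′ ≋ x ·ᵛ y)
  ⊥-parallel y y′ ⊥⇒⊥′ with y ≋0?
  -- Every vector is perpendicular to y = 0, in particular the unit vectors, so y′ = 0 and the
  -- scalar 0 will do.
  ... | yes y≋0 = 0# , λ r → begin
      y′ r      ≈⟨ e-∙ r y′ ⟨
      e r ∙ y′  ≈⟨ ⊥⇒⊥′ (e r) (trans (e-∙ r y) (y≋0 r)) ⟩
      0#        ≈⟨ zeroˡ (y r) ⟨
      0# * y r  ∎
  ... | no  y≉0 = parallel y y′ cross y≉0
    where
    y₀ = y zero
    y₁ = y (suc zero)
    y′₀ = y′ zero
    y′₁ = y′ (suc zero)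

    perpendicular : (y₁ ∷ - y₀ ∷ []) ∙ y ≈ 0#
    perpendicular = begin
      (y₁ ∷ - y₀ ∷ []) ∙ y  ≈⟨ ∙-pair y₁ (- y₀) y ⟩
      y₁ * y₀ + - y₀ * y₁   ≈⟨ +-cong (*-comm _ _) (sym (-‿distribˡ-* _ _)) ⟩
      y₀ * y₁ - y₀ * y₁     ≈⟨ -‿inverseʳ _ ⟩
      0#                    ∎

    y₁y′₀≈y₀y′₁ : y₁ * y′₀ ≈ y₀ * y′₁
    y₁y′₀≈y₀y′₁ = x-y≈0⇒x≈y (begin
      y₁ * y′₀ - y₀ * y′₁    ≈⟨ +-congˡ (-‿distribˡ-* _ _) ⟩
      y₁ * y′₀ + - y₀ * y′₁  ≈⟨ ∙-pair y₁ (- y₀) y′ ⟨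
      (y₁ ∷ - y₀ ∷ []) ∙ y′  ≈⟨ ⊥⇒⊥′ (y₁ ∷ - y₀ ∷ []) perpendicular ⟩
      0#                     ∎)

    cross : ∀ r s → y r * y′ s ≈ y s * y′ r
    cross zero       zero       = refl
    cross zero       (suc zero) = sym y₁y′₀≈y₀y′₁
    cross (suc zero) zero       = y₁y′₀≈y₀y′₁
    cross (suc zero) (suc zero) = refl

-- Powers of γ, and the actions of K on columns and rows over F.

n²-1≡[n+1][n-1] : ∀ n → n ℕ.^ 2 ∸ 1 ≡ (n ℕ.+ 1) ℕ.* (n ∸ 1)
n²-1≡[n+1][n-1] zero    = ≡.refl
n²-1≡[n+1][n-1] (suc p) = begin
  p ℕ.* 1 ℕ.+ p ℕ.* suc (p ℕ.* 1) ≡⟨ ≡.cong (λ x → x ℕ.+ p ℕ.* suc x) (ℕ.*-identityʳ p) ⟩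
  p ℕ.+ p ℕ.* suc p               ≡⟨ ≡.cong (p ℕ.+_) (ℕ.*-comm p (suc p)) ⟩
  suc (suc p) ℕ.* p               ≡⟨ ≡.cong (ℕ._* p) (ℕ.+-comm 1 (suc p)) ⟩
  (suc p ℕ.+ 1) ℕ.* p             ∎
  where open ≡.≡-Reasoning

module FieldReductionProperties
  {F : FiniteField c ℓ₁ ℓ₂ q} {K : FiniteField c′ ℓ₁′ ℓ₂′ (q ℕ.^ 2)} (R : FieldReduction F K) where
  open FieldReduction R
  open FiniteField F hiding (zero)
  open LinearAlgebra F
  open FiniteFieldProperties F
  open VectorProperties F
  open SemiringSum semiring
  open FiniteSums +-commutativeMonoid using (sum-single)
  open RingProperties ring using (+-identityˡ-unique)
  private
    module K where
      open FiniteField K public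
      open FiniteFieldProperties K public
      open LinearAlgebra K public using (_^ᶠ_; e; _+ᵛ_; _·ᵛ_)
      open VectorProperties K public using (e-≡; e-≢)
      open RingProperties (FiniteField.ring K) public using (//-rightDividesˡ)
      open SemiringExp (FiniteField.semiring K) public using (^-homo-*; ^-assocʳ; ^-congˡ)
      open CommutativeSemiringExp (FiniteField.commutativeSemiring K) public using (^-distrib-*)
    module ι = IsRingHomomorphism ι-isRingHomomorphism
    module φ = IsRingMonomorphism φ-isRingMonomorphism

  ι-^-homo : ∀ x n → ι (x ^ᶠ n) K.≈ ι x K.^ᶠ n
  ι-^-homo x zero    = ι.1#-homo
  ι-^-homo x (suc n) = K.trans (ι.*-homo x (x ^ᶠ n)) (K.*-congˡ (ι-^-homo x n))

  γ≉0 : ¬ (γ K.≈ K.0#)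
  γ≉0 = proj₁ γ-primitive

  γ^≉0 : ∀ i → ¬ (γ K.^ᶠ i K.≈ K.0#)
  γ^≉0 i = K.^-≉0 i γ≉0

  private
    -- The constant c disappears because c^(q - 1) = 1 already holds in F.
    scaled-power-^ : ∀ {c} i → ¬ (c ≈ 0#) → (ι c K.* γ K.^ᶠ i) K.^ᶠ (q ∸ 1) K.≈ γ K.^ᶠ (i ℕ.* (q ∸ 1))
    scaled-power-^ {c} i c≉0 = begin
      (ι c K.* γ K.^ᶠ i) K.^ᶠ (q ∸ 1)               ≈⟨ K.^-distrib-* (ι c) _ (q ∸ 1) ⟩
      ι c K.^ᶠ (q ∸ 1) K.* (γ K.^ᶠ i) K.^ᶠ (q ∸ 1)  ≈⟨ K.*-cong (K.sym (ι-^-homo c (q ∸ 1))) (K.^-assocʳ γ i (q ∸ 1)) ⟩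
      ι (c ^ᶠ (q ∸ 1)) K.* γ K.^ᶠ (i ℕ.* (q ∸ 1))   ≈⟨ K.*-congʳ (K.trans (ι.⟦⟧-cong (fermat c≉0)) ι.1#-homo) ⟩
      K.1# K.* γ K.^ᶠ (i ℕ.* (q ∸ 1))               ≈⟨ K.*-identityˡ _ ⟩
      γ K.^ᶠ (i ℕ.* (q ∸ 1))                        ∎
      where open SetoidReasoning K.setoid

    q+1∣-≤ : ∀ {c c′ i j} → i ≤ j → ¬ (c ≈ 0#) → ¬ (c′ ≈ 0#) →
             ι c K.* γ K.^ᶠ i K.≈ ι c′ K.* γ K.^ᶠ j → (q ℕ.+ 1) ℕ.∣ (j ∸ i)
    q+1∣-≤ {c} {c′} {i} {j} i≤j c≉0 c′≉0 eq = ℕ.*-cancelʳ-∣ (q ∸ 1)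
      (≡.subst (ℕ._∣ d ℕ.* (q ∸ 1)) (n²-1≡[n+1][n-1] q)
      (K.order-∣ γ-primitive (d ℕ.* (q ∸ 1)) (K.*-cancelˡ-≉0 (γ^≉0 (i ℕ.* (q ∸ 1))) (begin
        γ K.^ᶠ (i ℕ.* (q ∸ 1)) K.* γ K.^ᶠ (d ℕ.* (q ∸ 1)) ≈⟨ K.^-homo-* γ (i ℕ.* (q ∸ 1)) (d ℕ.* (q ∸ 1)) ⟨
        γ K.^ᶠ (i ℕ.* (q ∸ 1) ℕ.+ d ℕ.* (q ∸ 1))          ≡⟨ ≡.cong (γ K.^ᶠ_) (ℕ.*-distribʳ-+ (q ∸ 1) i d) ⟨
        γ K.^ᶠ ((i ℕ.+ d) ℕ.* (q ∸ 1))                    ≡⟨ ≡.cong (λ x → γ K.^ᶠ (x ℕ.* (q ∸ 1))) (ℕ.m+[n∸m]≡n i≤j) ⟩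
        γ K.^ᶠ (j ℕ.* (q ∸ 1))                            ≈⟨ scaled-power-^ j c′≉0 ⟨
        (ι c′ K.* γ K.^ᶠ j) K.^ᶠ (q ∸ 1)                  ≈⟨ K.^-congˡ (q ∸ 1) eq ⟨
        (ι c K.* γ K.^ᶠ i) K.^ᶠ (q ∸ 1)                   ≈⟨ scaled-power-^ i c≉0 ⟩
        γ K.^ᶠ (i ℕ.* (q ∸ 1))                            ≈⟨ K.*-identityʳ _ ⟨
        γ K.^ᶠ (i ℕ.* (q ∸ 1)) K.* K.1#                   ∎))))
      where
      open SetoidReasoning K.setoid
      d = j ∸ i
      instance
        q-1≢0 : NonZero (q ∸ 1)
        q-1≢0 = ℕ.>-nonZero (ℕ.m<n⇒0<n∸m 2≤q)

  -- Integer divisibility concerns absolute values and the equation is symmetric in (c , i) and (c′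
  -- , j), so the exponents may be taken in increasing order.
  q+1∣j-i : ∀ {c c′ i j} → ¬ (c ≈ 0#) → ¬ (c′ ≈ 0#) →
            ι c K.* γ K.^ᶠ i K.≈ ι c′ K.* γ K.^ᶠ j → (ℤ.+ (q ℕ.+ 1)) ℤ.∣ ((ℤ.+ j) ℤ.- (ℤ.+ i))
  q+1∣j-i {i = i} {j} c≉0 c′≉0 eq with ℕ.≤-total i j
  ... | inj₁ i≤j = ≡.subst ((q ℕ.+ 1) ℕ.∣_)
        (≡.sym (≡.trans (≡.cong ℤ.∣_∣ (ℤ.m-n≡m⊖n j i)) (≡.trans (ℤ.∣m⊖n∣≡∣n⊖m∣ j i) (ℤ.∣⊖∣-≤ i≤j))))
        (q+1∣-≤ i≤j c≉0 c′≉0 eq)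
  ... | inj₂ j≤i = ≡.subst ((q ℕ.+ 1) ℕ.∣_)
        (≡.sym (≡.trans (≡.cong ℤ.∣_∣ (ℤ.m-n≡m⊖n j i)) (ℤ.∣⊖∣-≤ j≤i)))
        (q+1∣-≤ j≤i c′≉0 c≉0 (K.sym eq))

  infixr 7 _⊛_
  -- Makes F² a one-dimensional vector space over K; the laws that follow hold because φ is a ring
  -- homomorphism and restricts to scalar matrices on F.
  _⊛_ : K.Carrier → Vector Carrier 2 → Vector Carrier 2
  z ⊛ y = φ z *ᵛ y

  ⊛-congˡ : ∀ z {y y′} → y ≋ y′ → z ⊛ y ≋ z ⊛ y′
  ⊛-congˡ z y≋y′ r = ∙-cong {u = φ z r} (λ _ → refl) y≋y′

  ⊛-congʳ : ∀ {z z′} y → z K.≈ z′ → z ⊛ y ≋ z′ ⊛ y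
  ⊛-congʳ y z≈z′ r = ∙-cong {v = y} (φ.⟦⟧-cong z≈z′ r) (λ _ → refl)

  ⊛-assoc : ∀ z w y → (z K.* w) ⊛ y ≋ z ⊛ w ⊛ y
  ⊛-assoc z w y r = trans (∙-cong {v = y} (φ.*-homo z w r) (λ _ → refl)) (ᵛ*-∙ (φ z r) (φ w) y)

  ⊛-identity : ∀ y → K.1# ⊛ y ≋ y
  ⊛-identity y r = trans (∙-cong {v = y} (φ.1#-homo r) (λ _ → refl)) (e-∙ r y)

  ⊛-zeroˡ : ∀ {z} y → z K.≈ K.0# → z ⊛ y ≋ 0ᵛ
  ⊛-zeroˡ y z≈0 r = trans (⊛-congʳ y z≈0 r) (trans (∙-cong {v = y} (φ.0#-homo r) (λ _ → refl)) (∙-zeroˡ y))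

  ⊛-zeroʳ : ∀ z {y} → y ≋ 0ᵛ → z ⊛ y ≋ 0ᵛ
  ⊛-zeroʳ z y≋0 r = trans (⊛-congˡ z y≋0 r) (∙-zeroʳ (φ z r))

  ⊛-distribʳ : ∀ y z w → (z K.+ w) ⊛ y ≋ z ⊛ y +ᵛ w ⊛ y
  ⊛-distribʳ y z w r = trans (∙-cong {v = y} (φ.+-homo z w r) (λ _ → refl)) (∙-distribʳ-+ y (φ z r) (φ w r))

  ι-⊛ : ∀ x y → ι x ⊛ y ≋ x ·ᵛ y
  ι-⊛ x y r = trans (∙-cong {v = y} (φ-ι x r) (λ _ → refl)) (trans (∙-·ˡ x (e r) y) (*-congˡ (e-∙ r y)))

  ⊛-· : ∀ z x y → z ⊛ (x ·ᵛ y) ≋ x ·ᵛ (z ⊛ y)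
  ⊛-· z x y r = ∙-·ʳ x (φ z r) y

  ⊛≋0⇒≋0 : ∀ {z y} → ¬ (z K.≈ K.0#) → z ⊛ y ≋ 0ᵛ → y ≋ 0ᵛ
  ⊛≋0⇒≋0 {z} {y} z≉0 zy≋0 r with K.inverse z≉0
  ... | w , zw≈1 = begin
    y r               ≈⟨ ⊛-identity y r ⟨
    (K.1# ⊛ y) r      ≈⟨ ⊛-congʳ y (K.trans (K.*-comm w z) zw≈1) r ⟨
    ((w K.* z) ⊛ y) r ≈⟨ ⊛-assoc w z y r ⟩
    (w ⊛ z ⊛ y) r     ≈⟨ ⊛-zeroʳ w zy≋0 r ⟩
    0#                ∎
    where open SetoidReasoning setoid

  ⊛-cancelʳ : ∀ {z w y} → ¬ (y ≋ 0ᵛ) → z ⊛ y ≋ w ⊛ y → z K.≈ w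
  ⊛-cancelʳ {z} {w} {y} y≉0 zy≋wy with (z K.- w) K.≟ K.0#
  ... | yes z-w≈0 = K.x-y≈0⇒x≈y z-w≈0
  ... | no  z-w≉0 = contradiction (⊛≋0⇒≋0 z-w≉0 λ r → +-identityˡ-unique _ ((w ⊛ y) r) (begin
      ((z K.- w) ⊛ y) r + (w ⊛ y) r ≈⟨ ⊛-distribʳ y (z K.- w) w r ⟨
      ((z K.- w K.+ w) ⊛ y) r       ≈⟨ ⊛-congʳ y (K.//-rightDividesˡ w z) r ⟩
      (z ⊛ y) r                     ≈⟨ zy≋wy r ⟩
      (w ⊛ y) r                     ∎)) y≉0
    where open SetoidReasoning setoid

  ᵛ*φ-zeroʳ : ∀ a {z} → z K.≈ K.0# → a ᵛ* φ z ≋ 0ᵛ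
  ᵛ*φ-zeroʳ a z≈0 j = trans
    (∙-cong {u = a} (λ _ → refl) (λ i → trans (φ.⟦⟧-cong z≈0 i j) (φ.0#-homo i j)))
    (∙-zeroʳ a)

  -- The mirror image of `⊛≋0⇒≋0`, with φ(z⁻¹) multiplied on the right. Messages are acted on as
  -- columns, whereas the points of a line consist of rows a φ(vₛ), so cancellation is needed on
  -- both sides.
  ᵛ*φ≋0⇒≋0 : ∀ {a z} → ¬ (z K.≈ K.0#) → a ᵛ* φ z ≋ 0ᵛ → a ≋ 0ᵛ
  ᵛ*φ≋0⇒≋0 {a} {z} z≉0 az≋0 j with K.inverse z≉0
  ... | w , zw≈1 = begin
    a j                       ≈⟨ ᵛ*-e a j ⟨
    (a ᵛ* e) j                ≈⟨ ∙-cong {u = a} (λ _ → refl) (λ i → φ.1#-homo i j) ⟨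
    (a ᵛ* φ K.1#) j           ≈⟨ ∙-cong {u = a} (λ _ → refl) (λ i → φ.⟦⟧-cong zw≈1 i j) ⟨
    (a ᵛ* φ (z K.* w)) j      ≈⟨ ∙-cong {u = a} (λ _ → refl) (λ i → φ.*-homo z w i j) ⟩
    a ∙ (φ z *ᵛ λ i → φ w i j) ≈⟨ ᵛ*-∙ a (φ z) (λ i → φ w i j) ⟨
    (a ᵛ* φ z) ∙ (λ i → φ w i j) ≈⟨ ∙-cong {v = λ i → φ w i j} az≋0 (λ _ → refl) ⟩
    0ᵛ ∙ (λ i → φ w i j)      ≈⟨ ∙-zeroˡ (λ i → φ w i j) ⟩
    0#                        ∎
    where open SetoidReasoning setoid

  ᵛ*φ-cancelˡ : ∀ {a z w} → ¬ (a ≋ 0ᵛ) → a ᵛ* φ z ≋ a ᵛ* φ w → z K.≈ w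
  ᵛ*φ-cancelˡ {a} {z} {w} a≉0 az≋aw with (z K.- w) K.≟ K.0#
  ... | yes z-w≈0 = K.x-y≈0⇒x≈y z-w≈0
  ... | no  z-w≉0 = contradiction (ᵛ*φ≋0⇒≋0 z-w≉0 λ j → +-identityˡ-unique _ ((a ᵛ* φ w) j) (begin
      (a ᵛ* φ (z K.- w)) j + (a ᵛ* φ w) j           ≈⟨ ∙-distribˡ-+ a (λ i → φ (z K.- w) i j) (λ i → φ w i j) ⟨
      a ∙ (λ i → φ (z K.- w) i j + φ w i j)         ≈⟨ ∙-cong {u = a} (λ _ → refl) (λ i → φ.+-homo (z K.- w) w i j) ⟨
      (a ᵛ* φ (z K.- w K.+ w)) j                    ≈⟨ ∙-cong {u = a} (λ _ → refl) (λ i → φ.⟦⟧-cong (K.//-rightDividesˡ w z) i j) ⟩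
      (a ᵛ* φ z) j                                  ≈⟨ az≋aw j ⟩
      (a ᵛ* φ w) j                                  ∎)) a≉0
    where open SetoidReasoning setoid

  ᵛ*φ-1 : ∀ a {z} → z K.≈ K.1# → a ᵛ* φ z ≋ a
  ᵛ*φ-1 a z≈1 j = trans
    (∙-cong {u = a} (λ _ → refl) (λ i → trans (φ.⟦⟧-cong z≈1 i j) (φ.1#-homo i j)))
    (ᵛ*-e a j)

  -- The 2 × 2t matrix whose row space is `φ̄ v`.
  blockMatrix : Vector K.Carrier t → Matrix 2 (t ℕ.* 2)
  blockMatrix v r = concat (λ ℓ → φ (v ℓ) r)

  block : Vector Carrier (t ℕ.* 2) → Fin t → Vector Carrier 2
  block u ℓ s = u (combine ℓ s)

  blocks-ext : {u u′ : Vector Carrier (t ℕ.* 2)} → (∀ ℓ → block u ℓ ≋ block u′ ℓ) → u ≋ u′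
  blocks-ext {t} eq c with Fin.combine-surjective {t} c
  ... | ℓ , s , ≡.refl = eq ℓ s

  nonzero-block : (u : Vector Carrier (t ℕ.* 2)) → ¬ (u ≋ 0ᵛ) → ∃[ ℓ ] (¬ (block u ℓ ≋ 0ᵛ))
  nonzero-block {t} u u≉0 = Fin.¬∀⟶∃¬ t (λ ℓ → block u ℓ ≋ 0ᵛ) (λ ℓ → block u ℓ ≋0?) (u≉0 ∘ blocks-ext)

  block-blockMatrix : ∀ a (v : Vector K.Carrier t) ℓ → block (a ᵛ* blockMatrix v) ℓ ≋ a ᵛ* φ (v ℓ)
  block-blockMatrix a v ℓ s = ∙-cong {u = a} (λ _ → refl) (λ r → reflexive (concat-combine (λ ℓ → φ (v ℓ) r) ℓ s))

  -- The right-hand side is Σ vₗ uₗ for the action `⊛`. By `ᵛ*-∙`, pairing it with a gives the value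
  -- of u at the point with coefficients a on the line of v.
  blockMatrix-*ᵛ : ∀ (v : Vector K.Carrier t) u → blockMatrix v *ᵛ u ≋ (λ r → sum (λ ℓ → (v ℓ ⊛ block u ℓ) r))
  blockMatrix-*ᵛ v u r = concat-∙ (λ ℓ → φ (v ℓ) r) u

  blockMatrix-+ : ∀ (v w : Vector K.Carrier t) u →
                  blockMatrix (v K.+ᵛ w) *ᵛ u ≋ blockMatrix v *ᵛ u +ᵛ blockMatrix w *ᵛ u
  blockMatrix-+ v w u r = begin
    (blockMatrix (v K.+ᵛ w) *ᵛ u) r                       ≈⟨ blockMatrix-*ᵛ (v K.+ᵛ w) u r ⟩
    sum (λ ℓ → ((v ℓ K.+ w ℓ) ⊛ block u ℓ) r)
      ≈⟨ sum-cong-≋ (λ ℓ → ⊛-distribʳ (block u ℓ) (v ℓ) (w ℓ) r) ⟩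
    sum (λ ℓ → (v ℓ ⊛ block u ℓ) r + (w ℓ ⊛ block u ℓ) r)
      ≈⟨ ∑-distrib-+ (λ ℓ → (v ℓ ⊛ block u ℓ) r) (λ ℓ → (w ℓ ⊛ block u ℓ) r) ⟩
    sum (λ ℓ → (v ℓ ⊛ block u ℓ) r) + sum (λ ℓ → (w ℓ ⊛ block u ℓ) r)
                                                          ≈⟨ +-cong (blockMatrix-*ᵛ v u r) (blockMatrix-*ᵛ w u r) ⟨
    (blockMatrix v *ᵛ u +ᵛ blockMatrix w *ᵛ u) r          ∎
    where open SetoidReasoning setoid

  -- The matrix φ(z) is pulled out by exchanging the two summations. With `blockMatrix-+` this makes
  -- the value of u linear over K in v, so that `Q` is evaluated from `P`.
  blockMatrix-· : ∀ z (v : Vector K.Carrier t) u → blockMatrix (z K.·ᵛ v) *ᵛ u ≋ z ⊛ (blockMatrix v *ᵛ u)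
  blockMatrix-· z v u r = begin
    (blockMatrix (z K.·ᵛ v) *ᵛ u) r                          ≈⟨ blockMatrix-*ᵛ (z K.·ᵛ v) u r ⟩
    sum (λ ℓ → ((z K.* v ℓ) ⊛ block u ℓ) r)                  ≈⟨ sum-cong-≋ (λ ℓ → ⊛-assoc z (v ℓ) (block u ℓ) r) ⟩
    sum (λ ℓ → φ z r ∙ (v ℓ ⊛ block u ℓ))                    ≈⟨ ∑-comm (λ ℓ s → φ z r s * (v ℓ ⊛ block u ℓ) s) ⟩
    sum (λ s → sum (λ ℓ → φ z r s * (v ℓ ⊛ block u ℓ) s))
      ≈⟨ sum-cong-≋ (λ s → *-distribˡ-sum (φ z r s) (λ ℓ → (v ℓ ⊛ block u ℓ) s)) ⟨
    φ z r ∙ (λ s → sum (λ ℓ → (v ℓ ⊛ block u ℓ) s))          ≈⟨ ⊛-congˡ z (blockMatrix-*ᵛ v u) r ⟨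
    (z ⊛ (blockMatrix v *ᵛ u)) r                             ∎
    where open SetoidReasoning setoid

  P-value : ∀ (ℓ : Fin t) u → blockMatrix (P ℓ) *ᵛ u ≋ block u ℓ
  P-value ℓ u r = begin
    (blockMatrix (P ℓ) *ᵛ u) r                ≈⟨ blockMatrix-*ᵛ (P ℓ) u r ⟩
    sum (λ m → (K.e ℓ m ⊛ block u m) r)       ≈⟨ sum-single _ ℓ (λ m m≢ℓ →
                                                    ⊛-zeroˡ (block u m) (K.e-≢ (m≢ℓ ∘ ≡.sym)) r) ⟩
    (K.e ℓ ℓ ⊛ block u ℓ) r                   ≈⟨ ⊛-congʳ (block u ℓ) (K.e-≡ {i = ℓ} ≡.refl) r ⟩
    (K.1# ⊛ block u ℓ) r                      ≈⟨ ⊛-identity (block u ℓ) r ⟩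
    block u ℓ r                               ∎
    where open SetoidReasoning setoid

  Q-value : ∀ (ℓ m : Fin t) i u → blockMatrix (Q ℓ m i) *ᵛ u ≋ block u ℓ +ᵛ (γ K.^ᶠ i) ⊛ block u m
  Q-value ℓ m i u r = trans (blockMatrix-+ (P ℓ) (γ K.^ᶠ i K.·ᵛ P m) u r)
    (+-cong (P-value ℓ u r)
            (trans (blockMatrix-· (γ K.^ᶠ i) (P m) u r) (⊛-congˡ (γ K.^ᶠ i) (P-value m u) r)))

-- The q + 1 points of the projective line over F.

module ProjectiveLine (F : FiniteField c ℓ₁ ℓ₂ q) where
  open FiniteField F hiding (zero)
  open LinearAlgebra F
  open FiniteFieldProperties F
  open VectorProperties F
  open RingProperties ring using (+-inverseʳ-unique)
  open Inverse enumeration using (to; from; to-cong; strictlyInverseˡ; strictlyInverseʳ)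

  -- Normalised representatives: the point at infinity (0 , 1) and the affine points (1 , x).
  point : Fin (suc q) → Vector Carrier 2
  point zero    = 0# ∷ 1# ∷ []
  point (suc x) = 1# ∷ from x ∷ []

  point-≉0 : ∀ p → ¬ (point p ≋ 0ᵛ)
  point-≉0 zero    eq = 1≉0 (eq (suc zero))
  point-≉0 (suc x) eq = 1≉0 (eq zero)

  normalise : ∀ a → ¬ (a ≋ 0ᵛ) → ∃[ p ] (a ∼ point p)
  normalise a a≉0 with a zero ≟ 0#
  ... | yes a₀≈0 = zero , a (suc zero) , (λ a₁≈0 → a≉0 λ { zero → a₀≈0 ; (suc zero) → a₁≈0 }) ,
        λ { zero → trans a₀≈0 (sym (zeroʳ _)) ; (suc zero) → sym (*-identityʳ _) }
  ... | no  a₀≉0 with inverse a₀≉0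
  ... | z , a₀z≈1 = suc (to (z * a (suc zero))) , a zero , a₀≉0 ,
        λ { zero → sym (*-identityʳ _) ; (suc zero) → begin
          a (suc zero)                              ≈⟨ *-identityˡ _ ⟨
          1# * a (suc zero)                         ≈⟨ *-congʳ a₀z≈1 ⟨
          a zero * z * a (suc zero)                 ≈⟨ *-assoc _ z _ ⟩
          a zero * (z * a (suc zero))               ≈⟨ *-congˡ (strictlyInverseʳ _) ⟨
          a zero * from (to (z * a (suc zero)))     ∎ }
    where open SetoidReasoning setoid

  point-injective : ∀ {p p′} → point p ∼ point p′ → p ≡ p′
  point-injective {zero}  {zero}  _ = ≡.refl
  point-injective {zero}  {suc _} (x , x≉0 , eq) = contradiction (trans (sym (*-identityʳ x)) (sym (eq zero))) x≉0
  point-injective {suc _} {zero}  (x , x≉0 , eq) = contradiction (trans (eq zero) (zeroʳ x)) 1≉0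
  point-injective {suc y} {suc y′} (x , x≉0 , eq) = ≡.cong suc (begin
    y           ≡⟨ strictlyInverseˡ y ⟨
    to (from y) ≡⟨ to-cong (trans (eq (suc zero))
                     (trans (*-congʳ (sym (trans (eq zero) (*-identityʳ x)))) (*-identityˡ _))) ⟩
    to (from y′) ≡⟨ strictlyInverseˡ y′ ⟩
    y′          ∎)
    where open ≡.≡-Reasoning

  private
    value : (y : Vector Carrier 2) → Fin (suc q) → ℕ
    value y p = fails (point p ∙ y ≟ 0#)

    zero-value : ∀ y → point zero ∙ y ≈ y (suc zero)
    zero-value y = trans (∙-pair 0# 1# y) (trans (+-cong (zeroˡ _) (*-identityˡ _)) (+-identityˡ _))

    suc-value : ∀ y x → point (suc x) ∙ y ≈ y zero + from x * y (suc zero)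
    suc-value y x = trans (∙-pair 1# (from x) y) (+-congʳ (*-identityˡ _))

  ⊥-count-≋0 : ∀ {y} → y ≋ 0ᵛ → ∑ (λ p → fails (point p ∙ y ≟ 0#)) ≡ 0
  ⊥-count-≋0 {y} y≋0 = ≡.trans
    (ℕ-Sum.sum-cong-≗ (λ p → fails-yes (point p ∙ y ≟ 0#)
      (trans (∙-cong {u = point p} (λ _ → refl) y≋0) (∙-zeroʳ (point p)))))
    (ℕ-Sum.sum-replicate-zero (suc q))

  -- Exactly one of the q + 1 points is orthogonal to y = (y₀ , y₁): the point at infinity if y₁ =
  -- 0, and (1 , -y₀/y₁) otherwise.
  ⊥-count-≉0 : ∀ {y} → ¬ (y ≋ 0ᵛ) → ∑ (λ p → fails (point p ∙ y ≟ 0#)) ≡ q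
  ⊥-count-≉0 {y} y≉0 with y (suc zero) ≟ 0#
  ... | yes y₁≈0 = ≡.cong₂ ℕ._+_ {x = value y zero}
        (fails-yes (point zero ∙ y ≟ 0#) (trans (zero-value y) y₁≈0))
        (≡.trans (ℕ-Sum.sum-cong-≗ (λ x → fails-no (point (suc x) ∙ y ≟ 0#) (suc-≉0 x))) (∑-ones q))
    where
    open SetoidReasoning setoid
    suc-≉0 : ∀ x → ¬ (point (suc x) ∙ y ≈ 0#)
    suc-≉0 x eq = y≉0 λ { zero → y₀≈0 ; (suc zero) → y₁≈0 }
      where
      y₀≈0 : y zero ≈ 0#
      y₀≈0 = begin
        y zero                       ≈⟨ +-identityʳ _ ⟨
        y zero + 0#                  ≈⟨ +-congˡ (trans (*-congˡ y₁≈0) (zeroʳ (from x))) ⟨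
        y zero + from x * y (suc zero) ≈⟨ suc-value y x ⟨
        point (suc x) ∙ y            ≈⟨ eq ⟩
        0#                           ∎
  ... | no y₁≉0 with inverse y₁≉0
  ... | z , y₁z≈1 = ≡.trans
        (≡.cong₂ ℕ._+_ {x = value y zero}
          (fails-no (point zero ∙ y ≟ 0#) (λ eq → y₁≉0 (trans (sym (zero-value y)) eq)))
          (≡.trans
            (sum-all-but-one (λ x → value y (suc x)) (to root)
              (fails-yes (point (suc (to root)) ∙ y ≟ 0#) root-zero)
              (λ x x≢root → fails-no (point (suc x) ∙ y ≟ 0#) (λ eq →
                x≢root (≡.trans (≡.sym (strictlyInverseˡ x)) (to-cong (root-unique x eq))))))
            (≡.trans (≡.sym (ℕ-Sum.sum-replicate (q ∸ 1))) (∑-ones (q ∸ 1)))))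
        suc[q-1]≡q
    where
    open FiniteSums ℕ.+-0-commutativeMonoid using (sum-all-but-one)
    open SetoidReasoning setoid
    root = - y zero * z

    root*y₁ : root * y (suc zero) ≈ - y zero
    root*y₁ = trans (*-assoc _ z _) (trans (*-congˡ (trans (*-comm z _) y₁z≈1)) (*-identityʳ _))

    root-zero : point (suc (to root)) ∙ y ≈ 0#
    root-zero = begin
      point (suc (to root)) ∙ y                 ≈⟨ suc-value y (to root) ⟩
      y zero + from (to root) * y (suc zero)    ≈⟨ +-congˡ (trans (*-congʳ (strictlyInverseʳ root)) root*y₁) ⟩
      y zero - y zero                           ≈⟨ -‿inverseʳ _ ⟩
      0#                                        ∎

    root-unique : ∀ x → point (suc x) ∙ y ≈ 0# → from x ≈ root
    root-unique x eq = *-cancelˡ-≉0 y₁≉0 (begin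
      y (suc zero) * from x   ≈⟨ *-comm _ _ ⟩
      from x * y (suc zero)   ≈⟨ +-inverseʳ-unique _ _ (trans (sym (suc-value y x)) eq) ⟩
      - y zero                ≈⟨ root*y₁ ⟨
      root * y (suc zero)     ≈⟨ *-comm _ _ ⟩
      y (suc zero) * root     ∎)

-- If x and y both equal the same member of the other pair, the reverse inclusions collapse that
-- pair too. Such pairs do occur: they index the lines `P`.
unordered-pair : {x y x′ y′ : A} → x ≡ x′ ⊎ x ≡ y′ → y ≡ x′ ⊎ y ≡ y′ →
                 x′ ≡ x ⊎ x′ ≡ y → y′ ≡ x ⊎ y′ ≡ y →
                 (x ≡ x′ × y ≡ y′) ⊎ (x ≡ y′ × y ≡ x′)
unordered-pair (inj₁ x≡x′)   (inj₂ y≡y′)   _             _             = inj₁ (x≡x′ , y≡y′)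
unordered-pair (inj₂ x≡y′)   (inj₁ y≡x′)   _             _             = inj₂ (x≡y′ , y≡x′)
unordered-pair (inj₁ ≡.refl) (inj₁ ≡.refl) _             (inj₁ ≡.refl) = inj₁ (≡.refl , ≡.refl)
unordered-pair (inj₁ ≡.refl) (inj₁ ≡.refl) _             (inj₂ ≡.refl) = inj₁ (≡.refl , ≡.refl)
unordered-pair (inj₂ ≡.refl) (inj₂ ≡.refl) (inj₁ ≡.refl) _             = inj₁ (≡.refl , ≡.refl)
unordered-pair (inj₂ ≡.refl) (inj₂ ≡.refl) (inj₂ ≡.refl) _             = inj₁ (≡.refl , ≡.refl)

-- The t² lines: disjointness, the values of a message, and proportional messages.

module Lines
  {F : FiniteField c ℓ₁ ℓ₂ q} {K : FiniteField c′ ℓ₁′ ℓ₂′ (q ℕ.^ 2)} (R : FieldReduction F K)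
  {t : ℕ} (i j : Fin t → Fin t → ℕ)
  (admissible : ∀ {ℓ m} → ℓ Fin.< m → AdmissibleExponents q (i ℓ m) (j ℓ m)) where
  open FieldReduction R
  open FieldReductionProperties R
  open FiniteField F hiding (zero)
  open LinearAlgebra F
  open FiniteFieldProperties F
  open VectorProperties F
  open ProjectiveLine F
  open RingProperties ring using (+-cancelˡ)
  private
    module K where
      open FiniteField K public
      open FiniteFieldProperties K public
      open LinearAlgebra K public using (_^ᶠ_)
      open VectorProperties K public using (e-≡; e-≢)

  -- The t² lines are indexed by all pairs: the diagonal carries the P ℓ, the
  -- two sides of it the two lines of each pair ℓ < m.
  line : Fin t → Fin t → Vector K.Carrier t
  line x y with Fin.<-cmp x y
  ... | tri< _ _ _ = Q x y (i x y)
  ... | tri≈ _ _ _ = P x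
  ... | tri> _ _ _ = Q y x (j y x)

  line-< : ∀ {x y} → x Fin.< y → line x y ≡ Q x y (i x y)
  line-< {x} {y} x<y with Fin.<-cmp x y
  ... | tri< _ _ _   = ≡.refl
  ... | tri≈ x≮y _ _ = contradiction x<y x≮y
  ... | tri> x≮y _ _ = contradiction x<y x≮y

  line-> : ∀ {x y} → x Fin.< y → line y x ≡ Q x y (j x y)
  line-> {x} {y} x<y with Fin.<-cmp y x
  ... | tri< _ _ y≯x = contradiction x<y y≯x
  ... | tri≈ _ _ y≯x = contradiction x<y y≯x
  ... | tri> _ _ _   = ≡.refl

  line-≡ : ∀ x → line x x ≡ P x
  line-≡ x with Fin.<-cmp x x
  ... | tri< _ x≢x _ = contradiction ≡.refl x≢x
  ... | tri≈ _ _ _   = ≡.refl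
  ... | tri> _ x≢x _ = contradiction ≡.refl x≢x

  ∈-line⇒∈-union : ∀ x y {w} → rowSpace (blockMatrix (line x y)) w → UnionOfLines i j w
  ∈-line⇒∈-union x y w∈ with Fin.<-cmp x y
  ... | tri< x<y _ _ = inj₂ (x , y , x<y , inj₁ w∈)
  ... | tri≈ _ _ _   = inj₁ (x , w∈)
  ... | tri> _ _ y<x = inj₂ (y , x , y<x , inj₂ w∈)

  ∈-union⇒∈-line : ∀ {w} → UnionOfLines i j w → ∃[ x ] ∃[ y ] rowSpace (blockMatrix (line x y)) w
  ∈-union⇒∈-line {w} (inj₁ (x , w∈)) =
    x , x , ≡.subst (λ v → rowSpace (blockMatrix v) w) (≡.sym (line-≡ x)) w∈
  ∈-union⇒∈-line {w} (inj₂ (x , y , x<y , inj₁ w∈)) =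
    x , y , ≡.subst (λ v → rowSpace (blockMatrix v) w) (≡.sym (line-< x<y)) w∈
  ∈-union⇒∈-line {w} (inj₂ (x , y , x<y , inj₂ w∈)) =
    y , x , ≡.subst (λ v → rowSpace (blockMatrix v) w) (≡.sym (line-> x<y)) w∈

  -- The congruence condition on the exponents enters here. With c = c′ = 1 it separates the two
  -- lines of a pair; with arbitrary constants it yields minimality.
  scaled-γ-powers-differ : ∀ {c c′ x y} → x Fin.< y → ¬ (c ≈ 0#) → ¬ (c′ ≈ 0#) →
                           ¬ (ι c K.* γ K.^ᶠ i x y K.≈ ι c′ K.* γ K.^ᶠ j x y)
  scaled-γ-powers-differ {x = x} {y} x<y c≉0 c′≉0 eq =
    AdmissibleExponents.i≢j (admissible x<y) (q+1∣j-i {i = i x y} {j = j x y} c≉0 c′≉0 eq)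

  γ-powers-differ : ∀ {x y} → x Fin.< y → ¬ (γ K.^ᶠ i x y K.≈ γ K.^ᶠ j x y)
  γ-powers-differ x<y eq = scaled-γ-powers-differ x<y 1≉0 1≉0 (K.*-congˡ eq)

  module _ {x y : Fin t} (n : ℕ) where
    Q-first : x ≢ y → Q x y n x K.≈ K.1#
    Q-first x≢y = K.trans
      (K.+-cong (K.e-≡ {i = x} ≡.refl) (K.trans (K.*-congˡ (K.e-≢ (x≢y ∘ ≡.sym))) (K.zeroʳ _)))
      (K.+-identityʳ _)

    Q-second : x ≢ y → Q x y n y K.≈ γ K.^ᶠ n
    Q-second x≢y = K.trans
      (K.+-cong (K.e-≢ x≢y) (K.trans (K.*-congˡ (K.e-≡ {i = y} ≡.refl)) (K.*-identityʳ _)))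
      (K.+-identityˡ _)

    Q-other : ∀ {s} → s ≢ x → s ≢ y → Q x y n s K.≈ K.0#
    Q-other s≢x s≢y = K.trans
      (K.+-cong (K.e-≢ (s≢x ∘ ≡.sym)) (K.trans (K.*-congˡ (K.e-≢ (s≢y ∘ ≡.sym))) (K.zeroʳ _)))
      (K.+-identityˡ _)

    Q-≉0 : ∀ {s} → x ≢ y → s ≡ x ⊎ s ≡ y → ¬ (Q x y n s K.≈ K.0#)
    Q-≉0 x≢y (inj₁ ≡.refl) eq = K.1≉0 (K.trans (K.sym (Q-first x≢y)) eq)
    Q-≉0 x≢y (inj₂ ≡.refl) eq = γ^≉0 n (K.trans (K.sym (Q-second x≢y)) eq)

  line-≉0 : ∀ x y {s} → s ≡ x ⊎ s ≡ y → ¬ (line x y s K.≈ K.0#)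
  line-≉0 x y s∈ with Fin.<-cmp x y
  ... | tri< _ x≢y _ = Q-≉0 (i x y) x≢y s∈
  line-≉0 x .x (inj₁ ≡.refl) | tri≈ _ ≡.refl _ = λ eq → K.1≉0 (K.trans (K.sym (K.e-≡ {i = x} ≡.refl)) eq)
  line-≉0 x .x (inj₂ ≡.refl) | tri≈ _ ≡.refl _ = λ eq → K.1≉0 (K.trans (K.sym (K.e-≡ {i = x} ≡.refl)) eq)
  line-≉0 x y (inj₁ s≡x) | tri> _ x≢y _ = Q-≉0 (j y x) (x≢y ∘ ≡.sym) (inj₂ s≡x)
  line-≉0 x y (inj₂ s≡y) | tri> _ x≢y _ = Q-≉0 (j y x) (x≢y ∘ ≡.sym) (inj₁ s≡y)

  line-≈0 : ∀ x y {s} → s ≢ x → s ≢ y → line x y s K.≈ K.0#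
  line-≈0 x y s≢x s≢y with Fin.<-cmp x y
  ... | tri< _ _ _ = Q-other (i x y) s≢x s≢y
  ... | tri≈ _ _ _ = K.e-≢ (s≢x ∘ ≡.sym)
  ... | tri> _ _ _ = Q-other (j y x) s≢y s≢x

  line-support : ∀ x y {s} → ¬ (line x y s K.≈ K.0#) → s ≡ x ⊎ s ≡ y
  line-support x y {s} ≉0 with s Fin.≟ x | s Fin.≟ y
  ... | yes s≡x | _       = inj₁ s≡x
  ... | no  _   | yes s≡y = inj₂ s≡y
  ... | no  s≢x | no  s≢y = contradiction (line-≈0 x y s≢x s≢y) ≉0

  -- In such a block a point of the line shows its coefficient vector unchanged, whence
  -- `line-injective`.
  line-1 : ∀ x y → ∃[ s ] (line x y s K.≈ K.1#)
  line-1 x y with Fin.<-cmp x y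
  ... | tri< _ x≢y _ = x , Q-first (i x y) x≢y
  ... | tri≈ _ _ _   = x , K.e-≡ {i = x} ≡.refl
  ... | tri> _ x≢y _ = y , Q-first (j y x) (x≢y ∘ ≡.sym)

  blocks-≋ : ∀ a a′ (v v′ : Vector K.Carrier t) → a ᵛ* blockMatrix v ≋ a′ ᵛ* blockMatrix v′ →
             ∀ s → a ᵛ* φ (v s) ≋ a′ ᵛ* φ (v′ s)
  blocks-≋ a a′ v v′ eq s r =
    trans (sym (block-blockMatrix a v s r)) (trans (eq (combine s r)) (block-blockMatrix a′ v′ s r))

  line-injective : ∀ a a′ x y → a ᵛ* blockMatrix (line x y) ≋ a′ ᵛ* blockMatrix (line x y) → a ≋ a′
  line-injective a a′ x y eq r with line-1 x y
  ... | s , vₛ≈1 = trans (sym (ᵛ*φ-1 a vₛ≈1 r))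
                    (trans (blocks-≋ a a′ (line x y) (line x y) eq s r) (ᵛ*φ-1 a′ vₛ≈1 r))

  -- Block x carries the coefficient 1 on both lines, so a = a′. Block y then reads a φ(γⁱ) = a
  -- φ(γʲ), and a nonzero row can be cancelled.
  Q-disjoint : ∀ a a′ {x y} → x Fin.< y → ¬ (a ≋ 0ᵛ) →
               ¬ (a ᵛ* blockMatrix (Q x y (i x y)) ≋ a′ ᵛ* blockMatrix (Q x y (j x y)))
  Q-disjoint a a′ {x} {y} x<y a≉0 eq = γ-powers-differ x<y (ᵛ*φ-cancelˡ {a = a} a≉0 λ r → begin
      (a ᵛ* φ (γ K.^ᶠ i x y)) r          ≈⟨ ∙-cong {u = a} (λ _ → refl) (λ s → φ-cong (Q-second (i x y) x≢y) s r) ⟨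
      (a ᵛ* φ (Q x y (i x y) y)) r       ≈⟨ blocks y r ⟩
      (a′ ᵛ* φ (Q x y (j x y) y)) r      ≈⟨ ∙-cong {u′ = a} (λ s → sym (a≋a′ s)) (λ s →
                                               φ-cong (Q-second (j x y) x≢y) s r) ⟩
      (a ᵛ* φ (γ K.^ᶠ j x y)) r          ∎)
    where
    open SetoidReasoning setoid
    open IsRingMonomorphism φ-isRingMonomorphism using () renaming (⟦⟧-cong to φ-cong)
    x≢y : x ≢ y
    x≢y = Fin.<⇒≢ x<y
    blocks = blocks-≋ a a′ (Q x y (i x y)) (Q x y (j x y)) eq
    a≋a′ : a ≋ a′
    a≋a′ r = trans (sym (ᵛ*φ-1 a (Q-first (i x y) x≢y) r)) (trans (blocks x r) (ᵛ*φ-1 a′ (Q-first (j x y) x≢y) r))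

  line-swap : ∀ a a′ {x y} → ¬ (a ≋ 0ᵛ) → ¬ (a′ ≋ 0ᵛ) →
              a ᵛ* blockMatrix (line x y) ≋ a′ ᵛ* blockMatrix (line y x) → x ≡ y
  line-swap a a′ {x} {y} a≉0 a′≉0 eq = decide (Fin.<-cmp x y)
    where
    decide : Tri (x Fin.< y) (x ≡ y) (y Fin.< x) → x ≡ y
    decide (tri≈ _ x≡y _) = x≡y
    decide (tri< x<y _ _) = contradiction
      (≡.subst₂ (λ v v′ → a ᵛ* blockMatrix v ≋ a′ ᵛ* blockMatrix v′) (line-< x<y) (line-> x<y) eq)
      (Q-disjoint a a′ x<y a≉0)
    decide (tri> _ _ y<x) = contradiction
      (≡.subst₂ (λ v v′ → a′ ᵛ* blockMatrix v ≋ a ᵛ* blockMatrix v′) (line-< y<x) (line-> y<x) (λ r → sym (eq r)))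
      (Q-disjoint a′ a y<x a′≉0)

  -- At a position in the support of the first line the block is a times an invertible matrix, hence
  -- nonzero, so the second line cannot have coefficient 0 there.
  support-⊆ : ∀ a a′ x y x′ y′ → ¬ (a ≋ 0ᵛ) →
              a ᵛ* blockMatrix (line x y) ≋ a′ ᵛ* blockMatrix (line x′ y′) →
              ∀ s → s ≡ x ⊎ s ≡ y → s ≡ x′ ⊎ s ≡ y′
  support-⊆ a a′ x y x′ y′ a≉0 eq s s∈ = line-support x′ y′ λ v′ₛ≈0 →
    a≉0 (ᵛ*φ≋0⇒≋0 {a = a} (line-≉0 x y s∈) λ r →
      trans (blocks-≋ a a′ (line x y) (line x′ y′) eq s r) (ᵛ*φ-zeroʳ a′ v′ₛ≈0 r))

  -- Comparing supports identifies the two indices up to order, and `line-swap` rules out a genuine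
  -- exchange. Equality of vectors suffices, since a projective factor can be absorbed into a′.
  line-disjoint : ∀ a a′ x y x′ y′ → ¬ (a ≋ 0ᵛ) → ¬ (a′ ≋ 0ᵛ) →
                  a ᵛ* blockMatrix (line x y) ≋ a′ ᵛ* blockMatrix (line x′ y′) → x ≡ x′ × y ≡ y′
  line-disjoint a a′ x y x′ y′ a≉0 a′≉0 eq = resolve
    (unordered-pair (⊆′ x (inj₁ ≡.refl)) (⊆′ y (inj₂ ≡.refl)) (⊇′ x′ (inj₁ ≡.refl)) (⊇′ y′ (inj₂ ≡.refl)))
    where
    ⊆′ = support-⊆ a a′ x y x′ y′ a≉0 eq
    ⊇′ = support-⊆ a′ a x′ y′ x y a′≉0 (λ r → sym (eq r))

    resolve : (x ≡ x′ × y ≡ y′) ⊎ (x ≡ y′ × y ≡ x′) → x ≡ x′ × y ≡ y′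
    resolve (inj₁ same)          = same
    resolve (inj₂ (x≡y′ , y≡x′)) = ≡.trans x≡y y≡x′ , ≡.trans (≡.sym x≡y) x≡y′
      where
      x≡y : x ≡ y
      x≡y = line-swap a a′ a≉0 a′≉0
        (≡.subst₂ (λ x′ y′ → a ᵛ* blockMatrix (line x y) ≋ a′ ᵛ* blockMatrix (line x′ y′))
          (≡.sym y≡x′) (≡.sym x≡y′) eq)

  value : Vector Carrier (t ℕ.* 2) → Fin t → Fin t → Vector Carrier 2
  value u x y = blockMatrix (line x y) *ᵛ u

  value-≡ : ∀ u x → value u x x ≋ block u x
  value-≡ u x = ≡.subst (λ v → blockMatrix v *ᵛ u ≋ block u x) (≡.sym (line-≡ x)) (P-value x u)

  value-< : ∀ u {x y} → x Fin.< y → value u x y ≋ block u x +ᵛ (γ K.^ᶠ i x y) ⊛ block u y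
  value-< u {x} {y} x<y = ≡.subst (λ v → blockMatrix v *ᵛ u ≋ block u x +ᵛ (γ K.^ᶠ i x y) ⊛ block u y)
    (≡.sym (line-< x<y)) (Q-value x y (i x y) u)

  value-> : ∀ u {x y} → x Fin.< y → value u y x ≋ block u x +ᵛ (γ K.^ᶠ j x y) ⊛ block u y
  value-> u {x} {y} x<y = ≡.subst (λ v → blockMatrix v *ᵛ u ≋ block u x +ᵛ (γ K.^ᶠ j x y) ⊛ block u y)
    (≡.sym (line-> x<y)) (Q-value x y (j x y) u)

  -- The values of u on the two lines of a pair are y + κ z and y + κ′ z.
  module _ (y z Y Y′ : Vector Carrier 2) (κ κ′ : K.Carrier)
           (Y≋ : Y ≋ y +ᵛ κ ⊛ z) (Y′≋ : Y′ ≋ y +ᵛ κ′ ⊛ z)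
           (κ≉0 : ¬ (κ K.≈ K.0#)) (κ′≉0 : ¬ (κ′ K.≈ K.0#)) (κ≉κ′ : ¬ (κ K.≈ κ′)) where
    private
      y+κz≋0⇒z≋0 : ∀ {κ Y} → ¬ (κ K.≈ K.0#) → Y ≋ y +ᵛ κ ⊛ z → y ≋ 0ᵛ → Y ≋ 0ᵛ → z ≋ 0ᵛ
      y+κz≋0⇒z≋0 κ≉0 Y≋ y≋0 Y≋0 = ⊛≋0⇒≋0 κ≉0 λ r →
        trans (sym (+-identityˡ _)) (trans (+-congʳ (sym (y≋0 r))) (trans (sym (Y≋ r)) (Y≋0 r)))

      y+κz≋0⇒y≋0 : ∀ {κ Y} → Y ≋ y +ᵛ κ ⊛ z → z ≋ 0ᵛ → Y ≋ 0ᵛ → y ≋ 0ᵛ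
      y+κz≋0⇒y≋0 {κ} Y≋ z≋0 Y≋0 r =
        trans (sym (+-identityʳ _)) (trans (+-congˡ (sym (⊛-zeroʳ κ z≋0 r))) (trans (sym (Y≋ r)) (Y≋0 r)))

      not-both-≋0 : ¬ (z ≋ 0ᵛ) → Y ≋ 0ᵛ → ¬ (Y′ ≋ 0ᵛ)
      not-both-≋0 z≉0 Y≋0 Y′≋0 = κ≉κ′ (⊛-cancelʳ z≉0 λ r → +-cancelˡ (y r) _ _
        (trans (sym (Y≋ r)) (trans (Y≋0 r) (trans (sym (Y′≋0 r)) (Y′≋ r)))))

    -- Any two of y, z, y + κz, y + κ′z determine y and z, because κ and κ′ are distinct and
    -- nonzero. So at most one of the four vanishes unless y = z = 0.
    three-nonzero : (y? : Dec (y ≋ 0ᵛ)) (z? : Dec (z ≋ 0ᵛ)) (Y? : Dec (Y ≋ 0ᵛ)) (Y′? : Dec (Y′ ≋ 0ᵛ)) →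
                    ¬ (y ≋ 0ᵛ) ⊎ ¬ (z ≋ 0ᵛ) → 3 ≤ fails y? ℕ.+ fails z? ℕ.+ (fails Y? ℕ.+ fails Y′?)
    three-nonzero (yes y≋0) (yes _)   _         _          (inj₁ y≉0) = contradiction y≋0 y≉0
    three-nonzero (yes _)   (yes z≋0) _         _          (inj₂ z≉0) = contradiction z≋0 z≉0
    three-nonzero (yes y≋0) (no z≉0)  (yes Y≋0) _          _ = contradiction (y+κz≋0⇒z≋0 κ≉0 Y≋ y≋0 Y≋0) z≉0
    three-nonzero (yes y≋0) (no z≉0)  (no _)    (yes Y′≋0) _ = contradiction (y+κz≋0⇒z≋0 κ′≉0 Y′≋ y≋0 Y′≋0) z≉0
    three-nonzero (yes _)   (no _)    (no _)    (no _)     _ = ℕ.≤-refl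
    three-nonzero (no y≉0)  (yes z≋0) (yes Y≋0) _          _ = contradiction (y+κz≋0⇒y≋0 Y≋ z≋0 Y≋0) y≉0
    three-nonzero (no y≉0)  (yes z≋0) (no _)    (yes Y′≋0) _ = contradiction (y+κz≋0⇒y≋0 Y′≋ z≋0 Y′≋0) y≉0
    three-nonzero (no _)    (yes _)   (no _)    (no _)     _ = ℕ.≤-refl
    three-nonzero (no _)    (no z≉0)  (yes Y≋0) (yes Y′≋0) _ = contradiction Y′≋0 (not-both-≋0 z≉0 Y≋0)
    three-nonzero (no _)    (no _)    (yes _)   (no _)     _ = ℕ.≤-refl
    three-nonzero (no _)    (no _)    (no _)    _          _ = s≤s (s≤s (s≤s z≤n))

  nonzeroAt : Vector Carrier (t ℕ.* 2) → Fin t → Fin t → ℕ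
  nonzeroAt u x y = fails (value u x y ≋0?)

  nonzeroLines : Vector Carrier (t ℕ.* 2) → ℕ
  nonzeroLines u = ∑ (λ x → ∑ (nonzeroAt u x))

  nonzeroAt-≡ : ∀ u x → nonzeroAt u x x ≡ fails (block u x ≋0?)
  nonzeroAt-≡ u x = fails-cong (value u x x ≋0?) (block u x ≋0?)
    (λ eq r → trans (sym (value-≡ u x r)) (eq r)) (λ eq r → trans (value-≡ u x r) (eq r))

  pair-≥3 : ∀ u {x y} → x Fin.< y → ¬ (block u x ≋ 0ᵛ) ⊎ ¬ (block u y ≋ 0ᵛ) →
            3 ≤ nonzeroAt u x x ℕ.+ nonzeroAt u y y ℕ.+ (nonzeroAt u x y ℕ.+ nonzeroAt u y x)
  pair-≥3 u {x} {y} x<y nz = ≡.subst₂ (λ a b → 3 ≤ a ℕ.+ b ℕ.+ (nonzeroAt u x y ℕ.+ nonzeroAt u y x))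
    (≡.sym (nonzeroAt-≡ u x)) (≡.sym (nonzeroAt-≡ u y))
    (three-nonzero (block u x) (block u y) (value u x y) (value u y x) (γ K.^ᶠ i x y) (γ K.^ᶠ j x y)
      (value-< u x<y) (value-> u x<y) (γ^≉0 (i x y)) (γ^≉0 (j x y)) (γ-powers-differ x<y)
      (block u x ≋0?) (block u y ≋0?) (value u x y ≋0?) (value u y x ≋0?) nz)

  nonzeroAt-≡1 : ∀ u {x} → ¬ (block u x ≋ 0ᵛ) → nonzeroAt u x x ≡ 1
  nonzeroAt-≡1 u {x} x≉0 = ≡.trans (nonzeroAt-≡ u x) (fails-no (block u x ≋0?) x≉0)

  -- Of the three lines given by `pair-≥3` the line `P a` is set aside, as it is counted only once
  -- for all b.
  cross-≥2 : ∀ u {a b} → ¬ (block u a ≋ 0ᵛ) → b ≢ a →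
             2 ≤ nonzeroAt u a b ℕ.+ (nonzeroAt u b a ℕ.+ nonzeroAt u b b)
  cross-≥2 u {a} {b} a≉0 b≢a = decide (Fin.<-cmp a b)
    where
    f = nonzeroAt u

    rearrange : ∀ {A B C D} → A ≡ 1 → 3 ≤ A ℕ.+ B ℕ.+ (C ℕ.+ D) → 2 ≤ C ℕ.+ (D ℕ.+ B)
    rearrange {_} {B} {C} {D} ≡.refl 3≤ =
      ℕ.≤-trans (ℕ.s≤s⁻¹ 3≤) (ℕ.≤-reflexive (≡.trans (ℕ.+-comm B (C ℕ.+ D)) (ℕ.+-assoc C D B)))

    decide : Tri (a Fin.< b) (a ≡ b) (b Fin.< a) → 2 ≤ f a b ℕ.+ (f b a ℕ.+ f b b)
    decide (tri< a<b _ _) = rearrange {B = f b b} {f a b} {f b a} (nonzeroAt-≡1 u a≉0) (pair-≥3 u a<b (inj₁ a≉0))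
    decide (tri≈ _ a≡b _) = contradiction (≡.sym a≡b) b≢a
    decide (tri> _ _ b<a) = rearrange {B = f b b} {f a b} {f b a} (nonzeroAt-≡1 u a≉0)
      (≡.subst (3 ≤_) (≡.cong₂ ℕ._+_ (ℕ.+-comm (f b b) (f a a)) (ℕ.+-comm (f b a) (f a b)))
        (pair-≥3 u b<a (inj₂ a≉0)))

  nonzeroLines-≥ : ∀ u → ¬ (u ≋ 0ᵛ) → 2 ℕ.* t ∸ 1 ≤ nonzeroLines u
  nonzeroLines-≥ u u≉0 =
    let (a , a≉0) = nonzero-block u u≉0 in
    ∑∑-≥ (nonzeroAt u) a (ℕ.≤-reflexive (≡.sym (nonzeroAt-≡1 u a≉0))) (λ b → cross-≥2 u a≉0)

  nonzeroLines-≤ : ∀ u a → (∀ b → b ≢ a → block u b ≋ 0ᵛ) → nonzeroLines u ≤ 2 ℕ.* t ∸ 1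
  nonzeroLines-≤ u a others≋0 = ∑∑-≤ (nonzeroAt u) a (λ x y → fails-≤1 (value u x y ≋0?)) λ x y x≢a y≢a →
    ℕ.≤-reflexive (fails-yes (value u x y ≋0?) (value≋0 (others≋0 x x≢a) (others≋0 y y≢a)))
    where
    sum≋0 : ∀ {y z Y} κ → Y ≋ y +ᵛ κ ⊛ z → y ≋ 0ᵛ → z ≋ 0ᵛ → Y ≋ 0ᵛ
    sum≋0 κ Y≋ y≋0 z≋0 r = trans (Y≋ r) (trans (+-cong (y≋0 r) (⊛-zeroʳ κ z≋0 r)) (+-identityˡ 0#))

    value≋0 : ∀ {x y} → block u x ≋ 0ᵛ → block u y ≋ 0ᵛ → value u x y ≋ 0ᵛ
    value≋0 {x} {y} x≋0 y≋0 = decide (Fin.<-cmp x y)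
      where
      decide : Tri (x Fin.< y) (x ≡ y) (y Fin.< x) → value u x y ≋ 0ᵛ
      decide (tri< x<y _ _)    = sum≋0 (γ K.^ᶠ i x y) (value-< u x<y) x≋0 y≋0
      decide (tri≈ _ ≡.refl _) = λ r → trans (value-≡ u x r) (x≋0 r)
      decide (tri> _ _ y<x)    = sum≋0 (γ K.^ᶠ j y x) (value-> u y<x) y≋0 x≋0

  module _ (u u′ : Vector Carrier (t ℕ.* 2)) where
    -- Rewrites Y′ = μ Y through the blocks of u alone; λy passes κ because φ(κ) is linear over F.
    -- The result is the equation that `proportional` takes as input.
    scaled-sum : ∀ κ (Y Y′ : Vector Carrier 2) (x y : Fin t) {λx λy μ} →
                 Y ≋ block u x +ᵛ κ ⊛ block u y → Y′ ≋ block u′ x +ᵛ κ ⊛ block u′ y →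
                 block u′ x ≋ λx ·ᵛ block u x → block u′ y ≋ λy ·ᵛ block u y → Y′ ≋ μ ·ᵛ Y →
                 λx ·ᵛ block u x +ᵛ λy ·ᵛ (κ ⊛ block u y) ≋ μ ·ᵛ (block u x +ᵛ κ ⊛ block u y)
    scaled-sum κ Y Y′ x y {λx} {λy} {μ} Y≋ Y′≋ x≋ y≋ Y′≋μY r = begin
      λx * block u x r + λy * (κ ⊛ block u y) r     ≈⟨ +-cong (x≋ r) (⊛-· κ λy (block u y) r) ⟨
      block u′ x r + (κ ⊛ (λy ·ᵛ block u y)) r      ≈⟨ +-congˡ (⊛-congˡ κ y≋ r) ⟨
      block u′ x r + (κ ⊛ block u′ y) r             ≈⟨ Y′≋ r ⟨
      Y′ r                                          ≈⟨ Y′≋μY r ⟩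
      μ * Y r                                       ≈⟨ *-congˡ (Y≋ r) ⟩
      μ * (block u x r + (κ ⊛ block u y) r)         ∎
      where open SetoidReasoning setoid

    -- Otherwise block u x is a multiple of both γⁱ ⊛ block u y and γʲ ⊛ block u y,
    -- so γʲ⁻ⁱ would lie in the subfield F.
    scalars-agree : ∀ {x y} → x Fin.< y → ¬ (block u x ≋ 0ᵛ) → ¬ (block u y ≋ 0ᵛ) →
                    ∀ {λx λy μ ν} →
                    block u′ x ≋ λx ·ᵛ block u x → block u′ y ≋ λy ·ᵛ block u y →
                    value u′ x y ≋ μ ·ᵛ value u x y → value u′ y x ≋ ν ·ᵛ value u y x → λx ≈ λy
    scalars-agree {x} {y} x<y x≉0 y≉0 {λx} {λy} {μ} {ν} x≋ y≋ μ≋ ν≋ = decide (λx ≟ λy)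
      where
      multiple : ∀ n {Y Y′ μ} → ¬ (λx ≈ λy) →
                 Y ≋ block u x +ᵛ (γ K.^ᶠ n) ⊛ block u y → Y′ ≋ block u′ x +ᵛ (γ K.^ᶠ n) ⊛ block u′ y →
                 Y′ ≋ μ ·ᵛ Y → ∃[ c ] (¬ (c ≈ 0#) × block u x ≋ (ι c K.* γ K.^ᶠ n) ⊛ block u y)
      multiple n {Y} {Y′} λx≉λy Y≋ Y′≋ Y′≋μY =
        let (c , c≉0 , eq) = proportional (block u x) ((γ K.^ᶠ n) ⊛ block u y) x≉0
                               (y≉0 ∘ ⊛≋0⇒≋0 (γ^≉0 n)) λx≉λy
                               (scaled-sum (γ K.^ᶠ n) Y Y′ x y Y≋ Y′≋ x≋ y≋ Y′≋μY)
        in c , c≉0 , λ r → trans (eq r)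
             (sym (trans (⊛-assoc (ι c) (γ K.^ᶠ n) (block u y) r) (ι-⊛ c ((γ K.^ᶠ n) ⊛ block u y) r)))

      decide : Dec (λx ≈ λy) → λx ≈ λy
      decide (yes eq)   = eq
      decide (no λx≉λy) =
        let (c  , c≉0  , eq)  = multiple (i x y) λx≉λy (value-< u x<y) (value-< u′ x<y) μ≋
            (c′ , c′≉0 , eq′) = multiple (j x y) λx≉λy (value-> u x<y) (value-> u′ x<y) ν≋
        in contradiction (⊛-cancelʳ y≉0 (λ r → trans (sym (eq r)) (eq′ r)))
             (scaled-γ-powers-differ x<y c≉0 c′≉0)

    -- The scalar of one nonzero block s serves for all of u: other nonzero blocks share it by
    -- `scalars-agree`, and a zero block accepts any scalar.
    parallel-values⇒parallel : ¬ (u ≋ 0ᵛ) → (∀ x y → ∃[ μ ] (value u′ x y ≋ μ ·ᵛ value u x y)) →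
                               ∃[ μ ] (u′ ≋ μ ·ᵛ u)
    parallel-values⇒parallel u≉0 scalar = scale s , blocks-ext λ b → decide b (block u b ≋0?)
      where
      s : Fin t
      s = proj₁ (nonzero-block {t} u u≉0)
      s≉0 : ¬ (block u s ≋ 0ᵛ)
      s≉0 = proj₂ (nonzero-block {t} u u≉0)

      scale : Fin t → Carrier
      scale b = proj₁ (scalar b b)

      scale-block : ∀ b → block u′ b ≋ scale b ·ᵛ block u b
      scale-block b r = trans (sym (value-≡ u′ b r)) (trans (proj₂ (scalar b b) r) (*-congˡ (value-≡ u b r)))

      scale-≈ : ∀ b → ¬ (block u b ≋ 0ᵛ) → scale b ≈ scale s
      scale-≈ b b≉0 = compare (Fin.<-cmp b s)
        where
        compare : Tri (b Fin.< s) (b ≡ s) (s Fin.< b) → scale b ≈ scale s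
        compare (tri< b<s _ _) = scalars-agree b<s b≉0 s≉0 (scale-block b) (scale-block s)
          (proj₂ (scalar b s)) (proj₂ (scalar s b))
        compare (tri≈ _ b≡s _) = reflexive (≡.cong scale b≡s)
        compare (tri> _ _ s<b) = sym (scalars-agree s<b s≉0 b≉0 (scale-block s) (scale-block b)
          (proj₂ (scalar s b)) (proj₂ (scalar b s)))

      decide : ∀ b → Dec (block u b ≋ 0ᵛ) → block u′ b ≋ scale s ·ᵛ block u b
      decide b (no b≉0)  r = trans (scale-block b r) (*-congʳ (scale-≈ b b≉0))
      decide b (yes b≋0) r = trans (scale-block b r)
        (trans (*-congˡ (b≋0 r)) (trans (zeroʳ _) (sym (trans (*-congˡ (b≋0 r)) (zeroʳ _)))))

-- The code: columns as points of lines, parameters, minimality.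

module Code
  {F : FiniteField c ℓ₁ ℓ₂ q} {K : FiniteField c′ ℓ₁′ ℓ₂′ (q ℕ.^ 2)} (R : FieldReduction F K)
  {t : ℕ} (i j : Fin t → Fin t → ℕ)
  (admissible : ∀ {ℓ m} → ℓ Fin.< m → AdmissibleExponents q (i ℓ m) (j ℓ m))
  {n : ℕ} (G : LinearAlgebra.Matrix F (t ℕ.* 2) n)
  (columns : LinearAlgebra.ColumnsRepresentPointsOf F (FieldReduction.UnionOfLines R i j) G) where
  open LinearAlgebra F
  open FieldReduction R
  open FieldReductionProperties R
  open Lines R i j admissible
  open FiniteField F hiding (zero)
  open FiniteFieldProperties F
  open VectorProperties F
  open ProjectiveLine F
  open ColumnsRepresentPointsOf columns

  linePoint : Vector Carrier 2 → Fin t → Fin t → Vector Carrier (t ℕ.* 2)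
  linePoint a x y = a ᵛ* blockMatrix (line x y)

  linePoint-cong : ∀ {a a′} x y → a ≋ a′ → linePoint a x y ≋ linePoint a′ x y
  linePoint-cong x y a≋a′ c = ∙-cong {v = λ r → blockMatrix (line x y) r c} a≋a′ (λ _ → refl)

  linePoint-· : ∀ z a x y → linePoint (z ·ᵛ a) x y ≋ z ·ᵛ linePoint a x y
  linePoint-· z a x y c = ∙-·ˡ z a (λ r → blockMatrix (line x y) r c)

  linePoint-0 : ∀ x y → linePoint 0ᵛ x y ≋ 0ᵛ
  linePoint-0 x y c = ∙-zeroˡ (λ r → blockMatrix (line x y) r c)

  linePoint-≉0 : ∀ {a} x y → ¬ (a ≋ 0ᵛ) → ¬ (linePoint a x y ≋ 0ᵛ)
  linePoint-≉0 {a} x y a≉0 eq = a≉0 (line-injective a 0ᵛ x y λ c → trans (eq c) (sym (linePoint-0 x y c)))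

  linePoint-∼ : ∀ {a a′} x y → a ∼ a′ → linePoint a x y ∼ linePoint a′ x y
  linePoint-∼ {a} {a′} x y (z , z≉0 , eq) =
    z , z≉0 , λ c → trans (linePoint-cong x y eq c) (linePoint-· z a′ x y c)

  -- The projective factor z moves into the coefficient vector; disjointness then identifies the
  -- line, and injectivity along that line the point.
  linePoint-∼⇒≡ : ∀ p x y p′ x′ y′ → linePoint (point p) x y ∼ linePoint (point p′) x′ y′ →
                  ((x , y) , p) ≡ ((x′ , y′) , p′)
  linePoint-∼⇒≡ p x y p′ x′ y′ (z , z≉0 , eq) = cells-≡
    (line-disjoint (point p) (z ·ᵛ point p′) x y x′ y′ (point-≉0 p) (z≉0 ∘ ·≋0⇒≈0 (point-≉0 p′)) eq′)
    where
    eq′ : linePoint (point p) x y ≋ linePoint (z ·ᵛ point p′) x′ y′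
    eq′ c = trans (eq c) (sym (linePoint-· z (point p′) x′ y′ c))

    cells-≡ : x ≡ x′ × y ≡ y′ → ((x , y) , p) ≡ ((x′ , y′) , p′)
    cells-≡ (x≡x′ , y≡y′) = ≡.cong₂ _,_ (≡.cong₂ _,_ x≡x′ y≡y′) (point-injective (z , z≉0 ,
      line-injective (point p) (z ·ᵛ point p′) x y
        (≡.subst₂ (λ x′ y′ → linePoint (point p) x y ≋ linePoint (z ·ᵛ point p′) x′ y′)
          (≡.sym x≡x′) (≡.sym y≡y′) eq′)))

  column-of : ∀ {a} x y → ¬ (a ≋ 0ᵛ) → ∃[ k ] (linePoint a x y ∼ transpose G k)
  column-of {a} x y a≉0 = covering (linePoint a x y) (linePoint-≉0 x y a≉0) (∈-line⇒∈-union x y (a , λ _ → refl))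

  -- A line together with one of its q + 1 points.
  Cell : Set
  Cell = (Fin t × Fin t) × Fin (suc q)

  column : Cell → Fin n
  column ((x , y) , p) = proj₁ (column-of x y (point-≉0 p))

  column-∼ : ∀ x y p → linePoint (point p) x y ∼ transpose G (column ((x , y) , p))
  column-∼ x y p = proj₂ (column-of x y (point-≉0 p))

  cell-of : ∀ k → ∃[ x ] ∃[ y ] ∃[ p ] (transpose G k ∼ linePoint (point p) x y)
  cell-of k =
    let (x , y , a , w≋aB) = ∈-union⇒∈-line (inside k)
        (p , a∼p) = normalise a λ a≋0 → nonzero k λ c →
                      trans (w≋aB c) (trans (linePoint-cong x y a≋0 c) (linePoint-0 x y c))
    in x , y , p , ∼-trans (1# , 1≉0 , λ c → trans (w≋aB c) (sym (*-identityˡ _))) (linePoint-∼ x y a∼p)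

  cell : Fin n → Cell
  cell k = let (x , y , p , _) = cell-of k in (x , y) , p

  column-cell : ∀ k → column (cell k) ≡ k
  column-cell k = let (x , y , p , k∼) = cell-of k in ≡.sym (distinct (∼-trans k∼ (column-∼ x y p)))

  cell-column : ∀ s → cell (column s) ≡ s
  cell-column ((x , y) , p) =
    let (x′ , y′ , p′ , k∼) = cell-of (column ((x , y) , p)) in
    ≡.sym (linePoint-∼⇒≡ p x y p′ x′ y′ (∼-trans (column-∼ x y p) k∼))

  decode : Fin (t ℕ.* t ℕ.* suc q) → Cell
  decode s = let (xy , p) = remQuot (suc q) s in remQuot t xy , p

  encode : Cell → Fin (t ℕ.* t ℕ.* suc q)
  encode ((x , y) , p) = combine (combine x y) p

  decode-encode : ∀ s → decode (encode s) ≡ s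
  decode-encode ((x , y) , p) = ≡.trans
    (≡.cong (λ (xy , p) → remQuot {t} t xy , p) (Fin.remQuot-combine (combine x y) p))
    (≡.cong (_, p) (Fin.remQuot-combine x y))

  encode-decode : ∀ s → encode (decode s) ≡ s
  encode-decode s = ≡.trans
    (≡.cong (λ xy → combine xy (proj₂ (remQuot {t ℕ.* t} (suc q) s)))
            (Fin.combine-remQuot {t} t (proj₁ (remQuot {t ℕ.* t} (suc q) s))))
    (Fin.combine-remQuot {t ℕ.* t} (suc q) s)

  -- One inverse law is `distinct`, the other the disjointness of the lines. The bijection yields
  -- the length and turns sums over columns into sums over lines.
  cells↔columns : Permutation.Permutation (t ℕ.* t ℕ.* suc q) n
  cells↔columns = Permutation.permutation (column ∘ decode) (encode ∘ cell)
    (λ k → ≡.trans (≡.cong column (decode-encode (cell k))) (column-cell k))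
    (λ s → ≡.trans (≡.cong encode (cell-column (decode s))) (encode-decode s))

  ∑-columns : (f : Vector ℕ n) → ∑ f ≡ ∑ (λ x → ∑ (λ y → ∑ (λ p → f (column ((x , y) , p)))))
  ∑-columns f = begin
    ∑ f
      ≡⟨ ℕ-Sum.sum-permute f cells↔columns ⟩
    ∑ (λ s → f (column (decode s)))
      ≡⟨ sum-combine (t ℕ.* t) (λ s → f (column (decode s))) ⟩
    ∑ (λ (xy : Fin (t ℕ.* t)) → ∑ (λ (p : Fin (suc q)) → f (column (decode (combine xy p)))))
      ≡⟨ sum-combine t _ ⟩
    ∑ (λ (x : Fin t) → ∑ (λ (y : Fin t) → ∑ (λ (p : Fin (suc q)) →
      f (column (decode (combine (combine x y) p))))))
      ≡⟨ ℕ-Sum.sum-cong-≗ (λ x → ℕ-Sum.sum-cong-≗ (λ y → ℕ-Sum.sum-cong-≗ (λ p →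
           ≡.cong (f ∘ column) (decode-encode ((x , y) , p))))) ⟩
    ∑ (λ x → ∑ (λ y → ∑ (λ p → f (column ((x , y) , p)))))
      ∎
    where
    open ≡.≡-Reasoning
    open FiniteSums ℕ.+-0-commutativeMonoid using (sum-combine)

  codeword-value : ∀ u {a k} x y {z} → linePoint a x y ≋ z ·ᵛ transpose G k →
                   a ∙ value u x y ≈ z * (u ᵛ* G) k
  codeword-value u {a} {k} x y {z} eq = begin
    a ∙ value u x y              ≈⟨ ᵛ*-∙ a (blockMatrix (line x y)) u ⟨
    linePoint a x y ∙ u          ≈⟨ ∙-cong {v = u} eq (λ _ → refl) ⟩
    (z ·ᵛ transpose G k) ∙ u     ≈⟨ ∙-·ˡ z (transpose G k) u ⟩
    z * (transpose G k ∙ u)      ≈⟨ *-congˡ (∙-comm (transpose G k) u) ⟩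
    z * (u ᵛ* G) k               ∎
    where open SetoidReasoning setoid

  codeword-≈0 : ∀ u {a k} x y → linePoint a x y ∼ transpose G k → (u ᵛ* G) k ≈ 0# → a ∙ value u x y ≈ 0#
  codeword-≈0 u {a} {k} x y (z , _ , eq) v≈0 = trans (codeword-value u {a} {k} x y eq) (trans (*-congˡ v≈0) (zeroʳ z))

  value-≈0 : ∀ u {a k} x y → linePoint a x y ∼ transpose G k → a ∙ value u x y ≈ 0# → (u ᵛ* G) k ≈ 0#
  value-≈0 u {a} {k} x y (z , z≉0 , eq) av≈0 = x*y≈0⇒y≈0 z≉0 (trans (sym (codeword-value u {a} {k} x y eq)) av≈0)

  line-weight : ∀ u x y → ∑ (λ p → fails (point p ∙ value u x y ≟ 0#)) ≡ q ℕ.* nonzeroAt u x y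
  line-weight u x y = decide (value u x y ≋0?)
    where
    decide : (d : Dec (value u x y ≋ 0ᵛ)) → ∑ (λ p → fails (point p ∙ value u x y ≟ 0#)) ≡ q ℕ.* fails d
    decide (yes eq) = ≡.trans (⊥-count-≋0 eq) (≡.sym (ℕ.*-zeroʳ q))
    decide (no ≉0)  = ≡.trans (⊥-count-≉0 ≉0) (≡.sym (ℕ.*-identityʳ q))

  ω-codeword : ∀ u {v} → v ≋ u ᵛ* G → ω v ≡ q ℕ.* nonzeroLines u
  ω-codeword u {v} v≋uG = begin
    ω v
      ≡⟨ ω≡∑ v ⟩
    ∑ (λ k → fails (v k ≟ 0#))
      ≡⟨ ∑-columns (λ k → fails (v k ≟ 0#)) ⟩
    ∑ (λ x → ∑ (λ y → ∑ (λ p → fails (v (column ((x , y) , p)) ≟ 0#))))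
      ≡⟨ ℕ-Sum.sum-cong-≗ (λ x → ℕ-Sum.sum-cong-≗ (λ y → ℕ-Sum.sum-cong-≗ (λ p → fails-cong
           (v (column ((x , y) , p)) ≟ 0#) (point p ∙ value u x y ≟ 0#)
           (λ v≈0 → codeword-≈0 u {point p} x y (column-∼ x y p) (trans (sym (v≋uG _)) v≈0))
           (λ ≈0 → trans (v≋uG _) (value-≈0 u {point p} x y (column-∼ x y p) ≈0))))) ⟩
    ∑ (λ x → ∑ (λ y → ∑ (λ p → fails (point p ∙ value u x y ≟ 0#))))
      ≡⟨ ℕ-Sum.sum-cong-≗ (λ x → ℕ-Sum.sum-cong-≗ (λ y → line-weight u x y)) ⟩
    ∑ (λ x → ∑ (λ y → q ℕ.* nonzeroAt u x y))
      ≡⟨ ℕ-Sum.sum-cong-≗ (λ x → ∑-const-* q (nonzeroAt u x)) ⟩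
    ∑ (λ x → q ℕ.* ∑ (nonzeroAt u x))
      ≡⟨ ∑-const-* q (λ x → ∑ (nonzeroAt u x)) ⟩
    q ℕ.* nonzeroLines u
      ∎
    where open ≡.≡-Reasoning

  -- A nonzero a names a point of the line, which some column represents; there the zero passes from
  -- u to u′. This supplies the hypothesis of `⊥-parallel`.
  annihilator-⊆ : ∀ u u′ → (∀ k → (u ᵛ* G) k ≈ 0# → (u′ ᵛ* G) k ≈ 0#) →
                  ∀ x y a → a ∙ value u x y ≈ 0# → a ∙ value u′ x y ≈ 0#
  annihilator-⊆ u u′ ann⊆ x y a a∙≈0 = decide (a ≋0?)
    where
    decide : Dec (a ≋ 0ᵛ) → a ∙ value u′ x y ≈ 0#
    decide (yes a≋0) = trans (∙-cong {v = value u′ x y} a≋0 (λ _ → refl)) (∙-zeroˡ (value u′ x y))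
    decide (no a≉0)  = let (k , w∼k) = column-of x y a≉0 in
      codeword-≈0 u′ {a} x y w∼k (ann⊆ k (value-≈0 u {a} x y w∼k a∙≈0))

  -- The lines `P ℓ` already recover the message: the point with coefficients `e r` on `P ℓ` reads
  -- entry r of block ℓ.
  rows-independent : LinearlyIndependentRows G
  rows-independent u uG≋0 = blocks-ext λ ℓ r → begin
    block u ℓ r           ≈⟨ value-≡ u ℓ r ⟨
    value u ℓ ℓ r         ≈⟨ e-∙ r (value u ℓ ℓ) ⟨
    e r ∙ value u ℓ ℓ     ≈⟨ (let (k , w∼k) = column-of ℓ ℓ (e≉0 r) in codeword-≈0 u {e r} ℓ ℓ w∼k (uG≋0 k)) ⟩
    0#                    ∎
    where
    open SetoidReasoning setoid
    e≉0 : ∀ (r : Fin 2) → ¬ (e r ≋ 0ᵛ)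
    e≉0 r eq = 1≉0 (trans (sym (e-≡ {i = r} ≡.refl)) (eq r))

  ≉0⇒message≉0 : ∀ {u v} → v ≋ u ᵛ* G → ¬ (v ≋ 0ᵛ) → ¬ (u ≋ 0ᵛ)
  ≉0⇒message≉0 v≋uG v≉0 u≋0 = v≉0 λ k → trans (v≋uG k)
    (trans (∙-cong {v = transpose G k} u≋0 (λ _ → refl)) (∙-zeroˡ (transpose G k)))

  length-≡ : n ≡ ((q ℕ.+ 1) ℕ.* (2 ℕ.* t) ℕ.^ 2) ℕ./ 4
  length-≡ = begin
    n                                         ≡⟨ Permutation.↔⇒≡ cells↔columns ⟨
    -- The division by 4 is exact, because k is even.
    t ℕ.* t ℕ.* suc q                         ≡⟨ ℕ.m*n/n≡m _ 4 ⟨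
    (t ℕ.* t ℕ.* suc q ℕ.* 4) ℕ./ 4           ≡⟨ ≡.cong (ℕ._/ 4) (rearranged t q) ⟩
    ((q ℕ.+ 1) ℕ.* (2 ℕ.* t) ℕ.^ 2) ℕ./ 4     ∎
    where
    open ≡.≡-Reasoning
    rearranged : ∀ t q → t ℕ.* t ℕ.* suc q ℕ.* 4 ≡ (q ℕ.+ 1) ℕ.* ((2 ℕ.* t) ℕ.* ((2 ℕ.* t) ℕ.* 1))
    rearranged = solve-∀

  minimumWeight : 1 ≤ t → IsMinimumWeight (rowSpace G) (q ℕ.* (2 ℕ.* t ∸ 1))
  minimumWeight 1≤t = attained , λ v (u , v≋uG) v≉0 →
    ≡.subst (q ℕ.* (2 ℕ.* t ∸ 1) ≤_) (≡.sym (ω-codeword u v≋uG))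
      (ℕ.*-monoʳ-≤ q (nonzeroLines-≥ u (≉0⇒message≉0 v≋uG v≉0)))
    where
    first : Fin t
    first = fromℕ< 1≤t

    u : Vector Carrier (t ℕ.* 2)
    u = e (combine first zero)

    u≉0 : ¬ (u ≋ 0ᵛ)
    u≉0 eq = 1≉0 (trans (sym (e-≡ {i = combine first zero} ≡.refl)) (eq (combine first zero)))

    others≋0 : ∀ ℓ → ℓ ≢ first → block u ℓ ≋ 0ᵛ
    others≋0 ℓ ℓ≢first s = e-≢ λ eq → ℓ≢first (≡.sym (Fin.combine-injectiveˡ first zero ℓ s eq))

    attained : ∃[ v ] (rowSpace G v × ¬ (v ≋ 0ᵛ) × ω v ≡ q ℕ.* (2 ℕ.* t ∸ 1))
    attained = u ᵛ* G , (u , λ _ → refl) , u≉0 ∘ rows-independent u ,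
      ≡.trans (ω-codeword u (λ _ → refl))
        (≡.cong (q ℕ.*_) (ℕ.≤-antisym (nonzeroLines-≤ u first others≋0) (nonzeroLines-≥ u u≉0)))

  σ-⊆⇒zeros-⊆ : (v v′ : Vector Carrier n) → σ v′ ⊆ σ v → ∀ k → v k ≈ 0# → v′ k ≈ 0#
  σ-⊆⇒zeros-⊆ v v′ σ⊆ k vₖ≈0 = decide (v′ k ≟ 0#) ≡.refl
    where
    lookup-σ : ∀ w → lookup (σ w) k ≡ not (does (w k ≟ 0#))
    lookup-σ w = Vec.lookup∘tabulate (λ k → not (does (w k ≟ 0#))) k
    decide : (d : Dec (v′ k ≈ 0#)) → d ≡ (v′ k ≟ 0#) → v′ k ≈ 0#
    decide (yes eq) _ = eq
    -- Otherwise k would lie in `σ v′`, hence in `σ v`, although v vanishes at k.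
    decide (no _) d≡ with () ← ≡.trans
      (≡.sym (Vec.[]=⇒lookup (σ⊆ (Vec.lookup⇒[]= k (σ v′)
        (≡.trans (lookup-σ v′) (≡.cong (not ∘ does) (≡.sym d≡)))))))
      (≡.trans (lookup-σ v) (≡.cong not (dec-true (v k ≟ 0#) vₖ≈0)))

  minimal : IsMinimalCode (rowSpace G)
  minimal v (u , v≋uG) v≉0 v′ (u′ , v′≋u′G) σ⊆ =
    let (μ , u′≋μu) = parallel-values⇒parallel u u′ (≉0⇒message≉0 v≋uG v≉0) λ x y →
          ⊥-parallel (value u x y) (value u′ x y) (annihilator-⊆ u u′ zeros-⊆ x y)
    in μ , λ k → begin
      v′ k                 ≈⟨ v′≋u′G k ⟩
      (u′ ᵛ* G) k          ≈⟨ ∙-cong {v = transpose G k} u′≋μu (λ _ → refl) ⟩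
      ((μ ·ᵛ u) ᵛ* G) k    ≈⟨ ∙-·ˡ μ u (transpose G k) ⟩
      μ * (u ᵛ* G) k       ≈⟨ *-congˡ (v≋uG k) ⟨
      μ * v k              ∎
    where
    open SetoidReasoning setoid
    zeros-⊆ : ∀ k → (u ᵛ* G) k ≈ 0# → (u′ ᵛ* G) k ≈ 0#
    zeros-⊆ k uGₖ≈0 = trans (sym (v′≋u′G k)) (σ-⊆⇒zeros-⊆ v v′ σ⊆ k (trans (v≋uG k) uGₖ≈0))

  isCode : 1 ≤ t → Is[ ((q ℕ.+ 1) ℕ.* (2 ℕ.* t) ℕ.^ 2) ℕ./ 4 , 2 ℕ.* t , q ℕ.* (2 ℕ.* t ∸ 1) ]Code (rowSpace G)
  isCode 1≤t = record
    { length        = length-≡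
    ; isSubspace    = rowSpace-isSubspace G
    ; dimension     = rowSpace-dimension (ℕ.*-comm t 2) rows-independent
    ; minimumWeight = minimumWeight 1≤t
    }

open import Data.Nat.Base using (_+_; _*_; _^_; _/_)

proposition4p12 : {c ℓ₁ ℓ₂ c′ ℓ₁′ ℓ₂′ : Level} (q : ℕ) → IsPrimePower q →
    (F : FiniteField c ℓ₁ ℓ₂ q) (K : FiniteField c′ ℓ₁′ ℓ₂′ (q ^ 2)) (R : FieldReduction F K) →
    (t k : ℕ) → 1 ≤ t → k ≡ 2 * t →
    (i j : Fin t → Fin t → ℕ) →
    (∀ {ℓ m} → ℓ Fin.< m → AdmissibleExponents q (i ℓ m) (j ℓ m)) →
    let open LinearAlgebra F in
    {n : ℕ} (G : Matrix (t * 2) n) →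
    ColumnsRepresentPointsOf (FieldReduction.UnionOfLines R i j) G →
    Is[ ((q + 1) * k ^ 2) / 4 , k , q * (k ∸ 1) ]Code (rowSpace G) × IsMinimalCode (rowSpace G)
proposition4p12 q _ F K R t k 1≤t ≡.refl i j admissible G columns = isCode 1≤t , minimal
  where open Code R i j admissible G columns
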